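{- Let $n\ge 16$ be an integer. Then there do not exist polynomials $p,q,r,s\in\mathbb{C}[x]$ satisfying all of the following: (i) $p^n+q^n=r^n+s^n\neq 0$ (that is, the two sides are equal as polynomials and are not the zero polynomial); (ii) $\{p^n,q^n\}\neq\{r^n,s^n\}$ as sets; (iii) $\max\{\deg p,\deg q,\deg r,\deg s\}\ge 1$; (iv) $\gcd(p,q,r,s)=1$.
   Context: Here $\gcd(p,q,r,s)=1$ means that the four polynomials have no common nonconstant divisor in $\mathbb{C}[x]$ (they are not required to be pairwise coprime). -}

module Defs where

open import Algebra.Bundles.Raw using (RawRing)
import Algebra.Definitions.RawSemiring as RawSemiringDefinitions
open import Data.List.Base using (List; []; _∷_; map)
open import Data.List.Relation.Unary.All using (All)
open import Data.List.Relation.Unary.Any using (Any)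
open import Data.Nat.Base as ℕ using (ℕ; zero; suc)
import Data.Nat.Properties as ℕ
open import Data.Product.Base using (∃; _×_; _,_)
open import Data.Rational.Base as ℚ using (ℚ; 0ℚ; 1ℚ; ½; ∣_∣; 1/_; Positive; positive)
import Data.Rational.Properties as ℚ
open import Data.Rational.Solver using (module +-*-Solver)
open import Data.Sum.Base using (_⊎_)
open import Level using (Level; 0ℓ; _⊔_)
open import Relation.Binary.PropositionalEquality using (_≡_; refl; sym; trans; cong; subst)
open import Relation.Nullary.Negation.Core using (¬_)
open import Relation.Unary using (Pred)

-- Real numbers: Cauchy sequences of rationals, with two sequences equal
-- when their difference tends to 0. The quotient is kept as a setoid.

IsCauchy : (ℕ → ℚ) → Set
IsCauchy a = ∀ ε → 0ℚ ℚ.< ε →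
  ∃ λ N → ∀ m n → N ℕ.≤ m → N ℕ.≤ n → ∣ a m ℚ.- a n ∣ ℚ.< ε

record ℝ : Set where
  constructor mkℝ
  field
    seq    : ℕ → ℚ
    cauchy : IsCauchy seq

open ℝ public

infix 4 _≈ᴿ_

_≈ᴿ_ : ℝ → ℝ → Set
x ≈ᴿ y = ∀ ε → 0ℚ ℚ.< ε →
  ∃ λ N → ∀ n → N ℕ.≤ n → ∣ seq x n ℚ.- seq y n ∣ ℚ.< ε

const-cauchy : ∀ c → IsCauchy (λ _ → c)
const-cauchy c ε 0<ε = 0 , λ _ _ _ _ →
  subst (λ z → ∣ z ∣ ℚ.< ε) (sym (ℚ.+-inverseʳ c)) 0<ε

neg-cauchy : ∀ a → IsCauchy a → IsCauchy (λ n → ℚ.- a n)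
neg-cauchy a ca ε 0<ε with ca ε 0<ε
... | N , h = N , λ m n N≤m N≤n →
  subst (ℚ._< ε)
    (trans (sym (ℚ.∣-p∣≡∣p∣ (a m ℚ.- a n)))
           (cong ∣_∣ (ℚ.neg-distrib-+ (a m) (ℚ.- a n))))
    (h m n N≤m N≤n)

half-pos : ∀ ε → 0ℚ ℚ.< ε → 0ℚ ℚ.< ½ ℚ.* ε
half-pos ε 0<ε =
  ℚ.positive⁻¹ (½ ℚ.* ε) {{ℚ.pos*pos⇒pos ½ ε {{positive 0<ε}}}}

half+half : ∀ ε → ½ ℚ.* ε ℚ.+ ½ ℚ.* ε ≡ ε
half+half ε = trans (sym (ℚ.*-distribʳ-+ ε ½ ½)) (ℚ.*-identityˡ ε)

+-cauchy : ∀ a b → IsCauchy a → IsCauchy b → IsCauchy (λ n → a n ℚ.+ b n)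
+-cauchy a b ca cb ε 0<ε
  with ca (½ ℚ.* ε) (half-pos ε 0<ε) | cb (½ ℚ.* ε) (half-pos ε 0<ε)
... | M , h | N , k = M ℕ.⊔ N , λ m n m≥ n≥ → begin-strict
  ∣ (a m ℚ.+ b m) ℚ.- (a n ℚ.+ b n) ∣
    ≡⟨ cong ∣_∣ (rearrange (a m) (b m) (a n) (b n)) ⟩
  ∣ (a m ℚ.- a n) ℚ.+ (b m ℚ.- b n) ∣
    ≤⟨ ℚ.∣p+q∣≤∣p∣+∣q∣ (a m ℚ.- a n) (b m ℚ.- b n) ⟩
  ∣ a m ℚ.- a n ∣ ℚ.+ ∣ b m ℚ.- b n ∣
    <⟨ ℚ.+-mono-< (h m n (ℕ.m⊔n≤o⇒m≤o M N m≥) (ℕ.m⊔n≤o⇒m≤o M N n≥))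
                  (k m n (ℕ.m⊔n≤o⇒n≤o M N m≥) (ℕ.m⊔n≤o⇒n≤o M N n≥)) ⟩
  ½ ℚ.* ε ℚ.+ ½ ℚ.* ε
    ≡⟨ half+half ε ⟩
  ε ∎
  where
  open ℚ.≤-Reasoning
  rearrange : ∀ p q r s → (p ℚ.+ q) ℚ.- (r ℚ.+ s) ≡ (p ℚ.- r) ℚ.+ (q ℚ.- s)
  rearrange = solve 4 (λ p q r s →
    (p :+ q) :- (r :+ s) := (p :- r) :+ (q :- s)) refl
    where open +-*-Solver

bounded : ∀ a → IsCauchy a →
  ∃ λ B → Positive B × ∃ λ N → ∀ n → N ℕ.≤ n → ∣ a n ∣ ℚ.≤ B
bounded a ca with ca 1ℚ (ℚ.positive⁻¹ 1ℚ)
... | N , h =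
  1ℚ ℚ.+ ∣ a N ∣ ,
  ℚ.pos+nonNeg⇒pos 1ℚ ∣ a N ∣ {{ℚ.∣-∣-nonNeg (a N)}} ,
  N , λ n N≤n → begin
    ∣ a n ∣
      ≡⟨ cong ∣_∣ (split (a n) (a N)) ⟩
    ∣ (a n ℚ.- a N) ℚ.+ a N ∣
      ≤⟨ ℚ.∣p+q∣≤∣p∣+∣q∣ (a n ℚ.- a N) (a N) ⟩
    ∣ a n ℚ.- a N ∣ ℚ.+ ∣ a N ∣
      ≤⟨ ℚ.+-monoˡ-≤ ∣ a N ∣ (ℚ.<⇒≤ (h n N N≤n ℕ.≤-refl)) ⟩
    1ℚ ℚ.+ ∣ a N ∣ ∎
  where
  open ℚ.≤-Reasoning
  split : ∀ p q → p ≡ (p ℚ.- q) ℚ.+ q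
  split = solve 2 (λ p q → p := (p :- q) :+ q) refl
    where open +-*-Solver

scaled : ∀ a → IsCauchy a → ∀ B → Positive B → ∀ ε → 0ℚ ℚ.< ε →
  ∃ λ N → ∀ m n → N ℕ.≤ m → N ℕ.≤ n → B ℚ.* ∣ a m ℚ.- a n ∣ ℚ.< ε
scaled a ca B B>0 ε 0<ε with ca (B⁻¹ ℚ.* ε) 0<δ
  where
  instance
    _ = B>0
    _ = ℚ.pos⇒nonZero B
    _ = positive 0<ε
    _ = ℚ.1/pos⇒pos B
  B⁻¹ = 1/ B
  0<δ : 0ℚ ℚ.< B⁻¹ ℚ.* ε
  0<δ = ℚ.positive⁻¹ (B⁻¹ ℚ.* ε) {{ℚ.pos*pos⇒pos B⁻¹ ε}}
... | N , h = N , λ m n N≤m N≤n →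
  subst (B ℚ.* ∣ a m ℚ.- a n ∣ ℚ.<_)
    (trans (sym (ℚ.*-assoc B (1/ B) ε))
           (trans (cong (ℚ._* ε) (ℚ.*-inverseʳ B)) (ℚ.*-identityˡ ε)))
    (ℚ.*-monoʳ-<-pos B (h m n N≤m N≤n))
  where
  instance
    _ = B>0
    _ = ℚ.pos⇒nonZero B

*-close : ∀ p q r s A B ε → ∣ p ∣ ℚ.≤ A → ∣ s ∣ ℚ.≤ B →
  A ℚ.* ∣ q ℚ.- s ∣ ℚ.< ½ ℚ.* ε → B ℚ.* ∣ p ℚ.- r ∣ ℚ.< ½ ℚ.* ε →
  ∣ p ℚ.* q ℚ.- r ℚ.* s ∣ ℚ.< ε
*-close p q r s A B ε ∣p∣≤A ∣s∣≤B h k = begin-strict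
  ∣ p ℚ.* q ℚ.- r ℚ.* s ∣
    ≡⟨ cong ∣_∣ (rearrange p q r s) ⟩
  ∣ p ℚ.* (q ℚ.- s) ℚ.+ s ℚ.* (p ℚ.- r) ∣
    ≤⟨ ℚ.∣p+q∣≤∣p∣+∣q∣ (p ℚ.* (q ℚ.- s)) (s ℚ.* (p ℚ.- r)) ⟩
  ∣ p ℚ.* (q ℚ.- s) ∣ ℚ.+ ∣ s ℚ.* (p ℚ.- r) ∣
    ≤⟨ ℚ.+-mono-≤ (enlarge p (q ℚ.- s) A ∣p∣≤A) (enlarge s (p ℚ.- r) B ∣s∣≤B) ⟩
  A ℚ.* ∣ q ℚ.- s ∣ ℚ.+ B ℚ.* ∣ p ℚ.- r ∣
    <⟨ ℚ.+-mono-< h k ⟩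
  ½ ℚ.* ε ℚ.+ ½ ℚ.* ε
    ≡⟨ half+half ε ⟩
  ε ∎
  where
  open ℚ.≤-Reasoning
  rearrange : ∀ p q r s →
    p ℚ.* q ℚ.- r ℚ.* s ≡ p ℚ.* (q ℚ.- s) ℚ.+ s ℚ.* (p ℚ.- r)
  rearrange = solve 4 (λ p q r s →
    p :* q :- r :* s := p :* (q :- s) :+ s :* (p :- r)) refl
    where open +-*-Solver
  enlarge : ∀ p q C → ∣ p ∣ ℚ.≤ C → ∣ p ℚ.* q ∣ ℚ.≤ C ℚ.* ∣ q ∣
  enlarge p q C ∣p∣≤C =
    subst (ℚ._≤ C ℚ.* ∣ q ∣) (sym (ℚ.∣p*q∣≡∣p∣*∣q∣ p q))
      (ℚ.*-monoʳ-≤-nonNeg ∣ q ∣ {{ℚ.∣-∣-nonNeg q}} ∣p∣≤C)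

*-cauchy : ∀ a b → IsCauchy a → IsCauchy b → IsCauchy (λ n → a n ℚ.* b n)
*-cauchy a b ca cb ε 0<ε =
  let
    A , A>0 , N₁ , ∣a∣≤A = bounded a ca
    B , B>0 , N₂ , ∣b∣≤B = bounded b cb
    N₃ , h = scaled b cb A A>0 (½ ℚ.* ε) (half-pos ε 0<ε)
    N₄ , k = scaled a ca B B>0 (½ ℚ.* ε) (half-pos ε 0<ε)
    M₁ = N₁ ℕ.⊔ N₂
    M₂ = N₃ ℕ.⊔ N₄
  in M₁ ℕ.⊔ M₂ , λ m n m≥ n≥ →
    *-close (a m) (b m) (a n) (b n) A B ε
      (∣a∣≤A m (ℕ.m⊔n≤o⇒m≤o N₁ N₂ (ℕ.m⊔n≤o⇒m≤o M₁ M₂ m≥)))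
      (∣b∣≤B n (ℕ.m⊔n≤o⇒n≤o N₁ N₂ (ℕ.m⊔n≤o⇒m≤o M₁ M₂ n≥)))
      (h m n (ℕ.m⊔n≤o⇒m≤o N₃ N₄ (ℕ.m⊔n≤o⇒n≤o M₁ M₂ m≥))
             (ℕ.m⊔n≤o⇒m≤o N₃ N₄ (ℕ.m⊔n≤o⇒n≤o M₁ M₂ n≥)))
      (k m n (ℕ.m⊔n≤o⇒n≤o N₃ N₄ (ℕ.m⊔n≤o⇒n≤o M₁ M₂ m≥))
             (ℕ.m⊔n≤o⇒n≤o N₃ N₄ (ℕ.m⊔n≤o⇒n≤o M₁ M₂ n≥)))

infixl 6 _+ᴿ_ _-ᴿ_
infixl 7 _*ᴿ_
infix  8 -ᴿ_

_+ᴿ_ : ℝ → ℝ → ℝ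
x +ᴿ y = mkℝ (λ n → seq x n ℚ.+ seq y n)
  (+-cauchy (seq x) (seq y) (cauchy x) (cauchy y))

_*ᴿ_ : ℝ → ℝ → ℝ
x *ᴿ y = mkℝ (λ n → seq x n ℚ.* seq y n)
  (*-cauchy (seq x) (seq y) (cauchy x) (cauchy y))

-ᴿ_ : ℝ → ℝ
-ᴿ x = mkℝ (λ n → ℚ.- seq x n) (neg-cauchy (seq x) (cauchy x))

_-ᴿ_ : ℝ → ℝ → ℝ
x -ᴿ y = x +ᴿ (-ᴿ y)

fromℚ : ℚ → ℝ
fromℚ c = mkℝ (λ _ → c) (const-cauchy c)

record ℂ : Set where
  constructor _+i_
  field
    re im : ℝ

open ℂ public

ℂ-rawRing : RawRing 0ℓ 0ℓ
ℂ-rawRing = record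
  { Carrier = ℂ
  ; _≈_     = λ z w → re z ≈ᴿ re w × im z ≈ᴿ im w
  ; _+_     = λ z w → (re z +ᴿ re w) +i (im z +ᴿ im w)
  ; _*_     = λ z w → (re z *ᴿ re w -ᴿ im z *ᴿ im w)
                   +i (re z *ᴿ im w +ᴿ im z *ᴿ re w)
  ; -_      = λ z → (-ᴿ re z) +i (-ᴿ im z)
  ; 0#      = fromℚ 0ℚ +i fromℚ 0ℚ
  ; 1#      = fromℚ 1ℚ +i fromℚ 0ℚ
  }

module Polynomials {c ℓ : Level} (R : RawRing c ℓ) where

  private module R = RawRing R

  -- Coefficients are listed from the constant term upwards. Trailing zeros
  -- are allowed, so the length of the list does not determine the degree.
  Poly : Set c
  Poly = List R.Carrier

  coeff : Poly → ℕ → R.Carrier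
  coeff []      _       = R.0#
  coeff (a ∷ p) zero    = a
  coeff (a ∷ p) (suc k) = coeff p k

  private
    _⊕_ : Poly → Poly → Poly
    []      ⊕ q       = q
    (a ∷ p) ⊕ []      = a ∷ p
    (a ∷ p) ⊕ (b ∷ q) = (a R.+ b) ∷ (p ⊕ q)

    _⊛_ : Poly → Poly → Poly
    []      ⊛ q = []
    (a ∷ p) ⊛ q = map (a R.*_) q ⊕ (R.0# ∷ (p ⊛ q))

  rawRing : RawRing c ℓ
  rawRing = record
    { Carrier = Poly
    ; _≈_     = λ p q → ∀ k → coeff p k R.≈ coeff q k
    ; _+_     = _⊕_
    ; _*_     = _⊛_
    ; -_      = map R.-_
    ; 0#      = []
    ; 1#      = R.1# ∷ []
    }

  open RawRing rawRing public
    using (_≈_; _+_; _*_; 0#; 1#; rawSemiring)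
    renaming (-_ to neg)
  open RawSemiringDefinitions rawSemiring public using (_^_; _∣_)

  DegreeAtMost : Poly → ℕ → Set ℓ
  DegreeAtMost p d = ∀ k → d ℕ.< k → coeff p k R.≈ R.0#

  -- The degree is a relation, since equality of coefficients need not be
  -- decidable. The zero polynomial has no degree (equivalently, degree -∞).
  HasDegree : Poly → ℕ → Set ℓ
  HasDegree p d = ¬ (coeff p d R.≈ R.0#) × DegreeAtMost p d

  MaxDegree : List Poly → ℕ → Set (c ⊔ ℓ)
  MaxDegree ps d = Any (λ p → HasDegree p d) ps × All (λ p → DegreeAtMost p d) ps

  Nonconstant : Poly → Set ℓ
  Nonconstant t = ∃ λ d → HasDegree t d × 1 ℕ.≤ d

  GcdIsOne : List Poly → Set (c ⊔ ℓ)
  GcdIsOne ps = ¬ (∃ λ t → Nonconstant t × All (t ∣_) ps)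

  -- The set { p , q }, with membership up to equality of polynomials.
  ⟅_,_⟆ : Poly → Poly → Pred Poly ℓ
  ⟅ p , q ⟆ t = t ≈ p ⊎ t ≈ q

module ℂ[x] = Polynomials ℂ-rawRing

ℂ[x] : Set
ℂ[x] = ℂ[x].Poly

{-# OPTIONS --safe #-}
-- Write F, G, H, K for the n-th powers, so F + G = H + K. The Wronskian W of
-- three of them is, up to sign, that of any other three; hence it is divisible
-- by each product of three of pⁿ⁻², qⁿ⁻², rⁿ⁻², sⁿ⁻², and by Bézout by the product
-- of all four. If W ≠ 0, adding up the four degree bounds for W forces all
-- degrees to vanish. If W = 0, then F, G, H are linearly dependent over the
-- constants, which leaves a relation between three of the four powers with
-- nonzero constant coefficients; the same argument with 2×2 Wronskians applies.
--
-- Equality in ℂ is not decidable, but it is stable under double negation and the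
-- goal is negative, so every case distinction takes place under ¬ ¬.
module Submission where

open import Algebra.Bundles using (CommutativeRing)
open import Algebra.Bundles.Raw using (RawRing)
import Algebra.Definitions.RawMagma as RawMagmaDefinitions
import Algebra.Definitions.RawSemiring as RawSemiringDefinitions
import Algebra.Properties.AbelianGroup as AbelianGroupProperties
import Algebra.Properties.CommutativeMonoid.Mult as CommutativeMonoidMult
import Algebra.Properties.Group as GroupProperties
import Algebra.Properties.Monoid.Mult as MonoidMult
import Algebra.Properties.Monoid.Mult.TCOptimised as MonoidMult′
import Algebra.Properties.Ring as RingProperties
import Algebra.Properties.Semiring.Mult as SemiringMult
import Algebra.Properties.Semiring.Mult.TCOptimised as SemiringMult′
import Algebra.Solver.Ring as RingSolver
open import Algebra.Solver.Ring.AlmostCommutativeRing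
  using (_-Raw-AlmostCommutative⟶_; Induced-equivalence; fromCommutativeRing)
open import Data.Empty using (⊥; ⊥-elim)
open import Data.Integer.Base as ℤ using (ℤ; +_; -[1+_])
import Data.Integer.Properties as ℤ
open import Data.List.Base using ([]; _∷_; map; length)
open import Data.List.Relation.Unary.All using ([]; _∷_)
open import Data.List.Relation.Unary.Any using (Any; here; there)
open import Data.Maybe.Base using (just; nothing)
open import Data.Nat.Base as ℕ using (ℕ; zero; suc; _≤_; z≤n; s≤s)
import Data.Nat.Properties as ℕ
open import Data.Nat.Solver renaming (module +-*-Solver to ℕ-Solver)
open import Data.Product.Base using (∃; ∃₂; _×_; _,_; proj₁; proj₂; Σ-syntax)
open import Data.Rational.Base as ℚ
  using (ℚ; 0ℚ; 1ℚ; ½; ∣_∣; 1/_; positive; ≢-nonZero)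
import Data.Rational.Properties as ℚ
open import Data.Rational.Solver renaming (module +-*-Solver to ℚ-Solver)
open import Data.Sum.Base using (_⊎_; inj₁; inj₂)
open import Function.Base using (_∘_)
open import Level using (0ℓ; _⊔_) renaming (suc to lsuc)
open import Relation.Binary.Definitions using (WeaklyDecidable)
open import Relation.Binary.PropositionalEquality as ≡ using (_≡_; _≢_)
import Relation.Binary.Reasoning.Setoid as SetoidReasoning
open import Relation.Nullary.Decidable.Core using (Dec; yes; no; ¬¬-excluded-middle)
open import Relation.Nullary.Negation.Core using (¬_)
open import Relation.Unary using (_≐_)
open import Defs

-- The four polynomials are coprime only jointly, so the divisors of W cannot be combined by
-- pairwise coprimality. Each partial product of three powers misses one factor, and W times the
-- missing factor is divisible by the full product, so one Bézout relation among the four suffices.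
-- The equation F + G = H + K then removes any chosen power from that Bézout relation, so any three
-- of the powers are again jointly coprime, as the case of three terms requires.
--
-- When W = 0, the dependence among F, G, H does not involve K and is therefore independent of F + G
-- - H - K = 0. Combining the two removes a further power; a coefficient of the result can
-- degenerate only if F + G = 0 or the two sets of powers coincide.
--
-- The degree count puts n - 2 on all four degrees on one side, four times over, against n times
-- each degree, three times over, on the other. With S the sum of the degrees this reads (n - 8) S ≤
-- 0.
--
-- There is no fraction field: the kernel of the derivation serves as the field of constants, and
-- the usual argument that g / h has derivative 0 is replaced by a gcd and the fact that x divides D
-- x only if D x = 0.

module IntegerCoefficientSolver {c ℓ} (R : CommutativeRing c ℓ) where
  open CommutativeRing R
  open RingProperties ring
  open GroupProperties +-group using (⁻¹-involutive; ε⁻¹≈ε)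
  open AbelianGroupProperties +-abelianGroup using (⁻¹-∙-comm)
  open MonoidMult′ +-monoid renaming (_×_ to _·_) using (1+×; ×-homo-+)
  open SemiringMult′ semiring using (×1-homo-*)
  open SetoidReasoning setoid

  -- The solver must recognise when coefficients cancel, and equality in the rings at hand is
  -- undecidable, so identities are normalised over ℤ. The optimised multiple reduces `1 · 1#` to
  -- `1#`, so that `con (+ 1)` stands for `1#` itself.
  ⟦_⟧ℤ : ℤ → Carrier
  ⟦ + n ⟧ℤ      = n · 1#
  ⟦ -[1+ n ] ⟧ℤ = - (suc n · 1#)

  neg-homo : ∀ i → ⟦ ℤ.- i ⟧ℤ ≈ - ⟦ i ⟧ℤ
  neg-homo (+ zero)   = sym ε⁻¹≈ε
  neg-homo (+ suc n)  = refl
  neg-homo -[1+ n ]   = sym (⁻¹-involutive _)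

  ⊖-homo : ∀ m n → ⟦ m ℤ.⊖ n ⟧ℤ ≈ m · 1# - n · 1#
  ⊖-homo m zero = begin
    m · 1#        ≈⟨ +-identityʳ _ ⟨
    m · 1# + 0#   ≈⟨ +-congˡ ε⁻¹≈ε ⟨
    m · 1# - 0#   ∎
  ⊖-homo zero (suc n) = sym (+-identityˡ _)
  ⊖-homo (suc m) (suc n) = begin
    ⟦ suc m ℤ.⊖ suc n ⟧ℤ ≡⟨ ≡.cong ⟦_⟧ℤ (ℤ.[1+m]⊖[1+n]≡m⊖n m n) ⟩
    ⟦ m ℤ.⊖ n ⟧ℤ ≈⟨ ⊖-homo m n ⟩
    m · 1# - n · 1# ≈⟨ +-congʳ (+-identityˡ _) ⟨
    (0# + m · 1#) - n · 1# ≈⟨ +-congʳ (+-congʳ (-‿inverseʳ 1#)) ⟨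
    ((1# - 1#) + m · 1#) - n · 1# ≈⟨ +-congʳ (+-assoc _ _ _) ⟩
    (1# + (- 1# + m · 1#)) - n · 1# ≈⟨ +-congʳ (+-congˡ (+-comm _ _)) ⟩
    (1# + (m · 1# - 1#)) - n · 1# ≈⟨ +-congʳ (+-assoc _ _ _) ⟨
    ((1# + m · 1#) - 1#) - n · 1# ≈⟨ +-assoc _ _ _ ⟩
    (1# + m · 1#) + (- 1# - n · 1#) ≈⟨ +-congˡ (⁻¹-∙-comm _ _) ⟩
    (1# + m · 1#) - (1# + n · 1#) ≈⟨ +-cong (1+× m 1#) (-‿cong (1+× n 1#)) ⟨
    suc m · 1# - suc n · 1# ∎

  +-homo : ∀ i j → ⟦ i ℤ.+ j ⟧ℤ ≈ ⟦ i ⟧ℤ + ⟦ j ⟧ℤ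
  +-homo (+ m) (+ n) = ×-homo-+ 1# m n
  +-homo (+ m) -[1+ n ] = ⊖-homo m (suc n)
  +-homo -[1+ m ] (+ n) = trans (⊖-homo n (suc m)) (+-comm _ _)
  +-homo -[1+ m ] -[1+ n ] = begin
    - (suc (suc (m ℕ.+ n)) · 1#) ≡⟨ ≡.cong (λ k → - (suc k · 1#)) (≡.sym (ℕ.+-suc m n)) ⟩
    - ((suc m ℕ.+ suc n) · 1#) ≈⟨ -‿cong (×-homo-+ 1# (suc m) (suc n)) ⟩
    - (suc m · 1# + suc n · 1#) ≈⟨ ⁻¹-∙-comm _ _ ⟨
    - (suc m · 1#) - suc n · 1# ∎

  *-homo⁺ : ∀ m j → ⟦ + m ℤ.* j ⟧ℤ ≈ m · 1# * ⟦ j ⟧ℤ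
  *-homo⁺ m (+ n) = begin
    ⟦ + m ℤ.* + n ⟧ℤ ≡⟨ ≡.cong ⟦_⟧ℤ (ℤ.pos-* m n) ⟨
    (m ℕ.* n) · 1#   ≈⟨ ×1-homo-* m n ⟩
    m · 1# * n · 1#  ∎
  *-homo⁺ m -[1+ n ] = begin
    ⟦ + m ℤ.* -[1+ n ] ⟧ℤ        ≡⟨ ≡.cong ⟦_⟧ℤ (ℤ.neg-distribʳ-* (+ m) (+ suc n)) ⟨
    ⟦ ℤ.- (+ m ℤ.* + suc n) ⟧ℤ   ≈⟨ neg-homo (+ m ℤ.* + suc n) ⟩
    - ⟦ + m ℤ.* + suc n ⟧ℤ       ≡⟨ ≡.cong (λ i → - ⟦ i ⟧ℤ) (ℤ.pos-* m (suc n)) ⟨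
    - ((m ℕ.* suc n) · 1#)       ≈⟨ -‿cong (×1-homo-* m (suc n)) ⟩
    - (m · 1# * suc n · 1#)      ≈⟨ -‿distribʳ-* _ _ ⟩
    m · 1# * - (suc n · 1#)      ∎

  *-homo : ∀ i j → ⟦ i ℤ.* j ⟧ℤ ≈ ⟦ i ⟧ℤ * ⟦ j ⟧ℤ
  *-homo (+ m)    j = *-homo⁺ m j
  *-homo -[1+ m ] j = begin
    ⟦ -[1+ m ] ℤ.* j ⟧ℤ        ≡⟨ ≡.cong ⟦_⟧ℤ (ℤ.neg-distribˡ-* (+ suc m) j) ⟨
    ⟦ ℤ.- (+ suc m ℤ.* j) ⟧ℤ   ≈⟨ neg-homo (+ suc m ℤ.* j) ⟩
    - ⟦ + suc m ℤ.* j ⟧ℤ       ≈⟨ -‿cong (*-homo⁺ (suc m) j) ⟩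
    - (suc m · 1# * ⟦ j ⟧ℤ)    ≈⟨ -‿distribˡ-* _ _ ⟩
    - (suc m · 1#) * ⟦ j ⟧ℤ    ∎

  morphism : CommutativeRing.rawRing ℤ.+-*-commutativeRing
               -Raw-AlmostCommutative⟶ fromCommutativeRing R
  morphism = record
    { ⟦_⟧ = ⟦_⟧ℤ ; +-homo = +-homo ; *-homo = *-homo
    ; -‿homo = neg-homo ; 0-homo = refl ; 1-homo = refl }

  equalCoefficients : WeaklyDecidable (Induced-equivalence morphism)
  equalCoefficients i j with i ℤ.≟ j
  ... | yes ≡.refl = just refl
  ... | no  _      = nothing

  open RingSolver (CommutativeRing.rawRing ℤ.+-*-commutativeRing)
    (fromCommutativeRing R) morphism equalCoefficients public
    using (Polynomial; solve; _:+_; _:*_; _:-_; :-_; _:=_; con)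

module Zeros {c ℓ} (R : CommutativeRing c ℓ) where
  open CommutativeRing R
  open GroupProperties +-group using (ε⁻¹≈ε)

  x*0 : ∀ {x y} → y ≈ 0# → x * y ≈ 0#
  x*0 {x} h = trans (*-congˡ h) (zeroʳ x)

  0*x : ∀ {x y} → x ≈ 0# → x * y ≈ 0#
  0*x {y = y} h = trans (*-congʳ h) (zeroˡ y)

  0+0 : ∀ {x y} → x ≈ 0# → y ≈ 0# → x + y ≈ 0#
  0+0 h k = trans (+-cong h k) (+-identityˡ 0#)

  neg0 : ∀ {x} → x ≈ 0# → - x ≈ 0#
  neg0 h = trans (-‿cong h) ε⁻¹≈ε

-- Wronskians in a differential domain

record DifferentialDomain c ℓ : Set (lsuc (c ⊔ ℓ)) where
  field
    commutativeRing : CommutativeRing c ℓ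
  open CommutativeRing commutativeRing public
  field
    stable       : ∀ {x y} → ¬ ¬ (x ≈ y) → x ≈ y
    1≉0          : ¬ (1# ≈ 0#)
    zero-product : ∀ {x y} → ¬ (x ≈ 0#) → x * y ≈ 0# → y ≈ 0#

    D      : Carrier → Carrier
    D-cong : ∀ {x y} → x ≈ y → D x ≈ D y
    D-+    : ∀ x y → D (x + y) ≈ D x + D y
    D-*    : ∀ x y → D (x * y) ≈ D x * y + x * D y

    -- Upper bounds can be propagated through sums and derivatives without locating a leading
    -- coefficient. An exact degree requires deciding which coefficients vanish, so it is available
    -- only under ¬ ¬.
    Deg Deg≤ : Carrier → ℕ → Set ℓ
    Deg≤-cong : ∀ {x y d} → x ≈ y → Deg≤ x d → Deg≤ y d
    Deg≤-+    : ∀ {x y d} → Deg≤ x d → Deg≤ y d → Deg≤ (x + y) d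
    Deg≤-neg  : ∀ {x d} → Deg≤ x d → Deg≤ (- x) d
    Deg≤-*    : ∀ {x y d e} → Deg≤ x d → Deg≤ y e → Deg≤ (x * y) (d ℕ.+ e)
    Deg≤-D    : ∀ {x d} → Deg≤ x d → Deg≤ (D x) d
    Deg⇒Deg≤  : ∀ {x d} → Deg x d → Deg≤ x d
    Deg-least : ∀ {x d e} → Deg x d → Deg≤ x e → d ℕ.≤ e
    Deg-1     : Deg 1# 0
    Deg-*     : ∀ {x y d e} → Deg x d → Deg y e → Deg (x * y) (d ℕ.+ e)
    Deg-exists : ∀ {x} → ¬ (x ≈ 0#) → ¬ ¬ ∃ (Deg x)
    Deg≤0⇒D≈0 : ∀ {x} → Deg≤ x 0 → D x ≈ 0#
    D≈0⇒Deg≤0 : ∀ {x} → D x ≈ 0# → Deg≤ x 0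
    Deg0-unit  : ∀ {x} → Deg x 0 → ¬ ¬ ∃ λ y → x * y ≈ 1#
    -- For polynomials, D lowers the degree, so a nonzero D x is no multiple of x. `Deg≤-D` does not
    -- record this drop; here it is turned into the tool that proves elements constant.
    D-multiple : ∀ {x y} → D x ≈ x * y → D x ≈ 0#

    gcd : ∀ x y → ¬ ¬ (Σ[ t ∈ Carrier ] Σ[ a ∈ Carrier ] Σ[ b ∈ Carrier ]
      Σ[ u ∈ Carrier ] Σ[ v ∈ Carrier ]
      (x ≈ t * a) × (y ≈ t * b) × (u * a + v * b ≈ 1#))

module EqualPowerSums {c ℓ} (𝔻 : DifferentialDomain c ℓ) where
  open DifferentialDomain 𝔻
  open RawSemiringDefinitions (RawRing.rawSemiring rawRing) using (_^_)
  open IntegerCoefficientSolver commutativeRing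
  open Zeros commutativeRing
  open SetoidReasoning setoid

  by-cases : ∀ {a} {A : Set a} {x y} → (A → x ≈ y) → (¬ A → x ≈ y) → x ≈ y
  by-cases f g = stable λ ¬eq → ¬¬-excluded-middle λ where
    (yes a) → ¬eq (f a)
    (no ¬a) → ¬eq (g ¬a)

  x-y≈0⇒x≈y : ∀ {x y} → x - y ≈ 0# → x ≈ y
  x-y≈0⇒x≈y {x} {y} h = begin
    x            ≈⟨ solve 2 (λ x y → x := (x :- y) :+ y) refl x y ⟩
    (x - y) + y  ≈⟨ +-congʳ h ⟩
    0# + y       ≈⟨ +-identityˡ y ⟩
    y            ∎

  x≈y⇒x-y≈0 : ∀ {x y} → x ≈ y → x - y ≈ 0#
  x≈y⇒x-y≈0 {y = y} h = trans (+-congʳ h) (-‿inverseʳ y)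

  ≉-* : ∀ {x y} → ¬ (x ≈ 0#) → ¬ (y ≈ 0#) → ¬ (x * y ≈ 0#)
  ≉-* x≉0 y≉0 xy≈0 = y≉0 (zero-product x≉0 xy≈0)

  ≉-neg : ∀ {x} → ¬ (x ≈ 0#) → ¬ (- x ≈ 0#)
  ≉-neg {x} x≉0 h = x≉0 (trans (solve 1 (λ x → x := :- (:- x)) refl x) (neg0 h))

  D-1 : D 1# ≈ 0#
  D-1 = Deg≤0⇒D≈0 (Deg⇒Deg≤ Deg-1)

  D-0 : D 0# ≈ 0#
  D-0 = begin
    D 0#                  ≈⟨ solve 1 (λ x → x := (x :+ x) :- x) refl (D 0#) ⟩
    (D 0# + D 0#) - D 0#  ≈⟨ +-congʳ (D-+ 0# 0#) ⟨
    D (0# + 0#) - D 0#    ≈⟨ +-congʳ (D-cong (+-identityˡ 0#)) ⟩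
    D 0# - D 0#           ≈⟨ -‿inverseʳ _ ⟩
    0#                    ∎

  D-neg : ∀ x → D (- x) ≈ - D x
  D-neg x = x-y≈0⇒x≈y (begin
    D (- x) - (- D x)   ≈⟨ solve 2 (λ a b → a :- (:- b) := a :+ b) refl (D (- x)) (D x) ⟩
    D (- x) + D x       ≈⟨ D-+ (- x) x ⟨
    D (- x + x)         ≈⟨ D-cong (-‿inverseˡ x) ⟩
    D 0#                ≈⟨ D-0 ⟩
    0#                  ∎)

  D-minus : ∀ x y → D (x - y) ≈ D x - D y
  D-minus x y = trans (D-+ x (- y)) (+-congˡ (D-neg y))

  D-scale : ∀ {a} → D a ≈ 0# → ∀ x → D (a * x) ≈ a * D x
  D-scale {a} Da≈0 x =
    trans (D-* a x) (trans (+-congʳ (0*x Da≈0)) (+-identityˡ _))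

  -- The constants take the place of the ground field: the coefficients of every linear dependence
  -- below are of this kind.
  Const : Carrier → Set ℓ
  Const x = D x ≈ 0#

  const-* : ∀ {x y} → Const x → Const y → Const (x * y)
  const-* hx hy = trans (D-scale hx _) (x*0 hy)

  const-+ : ∀ {x y} → Const x → Const y → Const (x + y)
  const-+ hx hy = trans (D-+ _ _) (0+0 hx hy)

  const-neg : ∀ {x} → Const x → Const (- x)
  const-neg hx = trans (D-neg _) (neg0 hx)

  const-of-equal : ∀ {x y} → x ≈ y → Const x → Const y
  const-of-equal x≈y hx = trans (D-cong (sym x≈y)) hx

  D-wronskian : ∀ x y → D (x * D y - D x * y) ≈ x * D (D y) - D (D x) * y
  D-wronskian x y = begin
    D (x * D y - D x * y)
      ≈⟨ D-minus _ _ ⟩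
    D (x * D y) - D (D x * y)
      ≈⟨ +-cong (D-* _ _) (-‿cong (D-* _ _)) ⟩
    (D x * D y + x * D (D y)) - (D (D x) * y + D x * D y)
      ≈⟨ solve 3 (λ a b c → (a :+ b) :- (c :+ a) := b :- c) refl _ _ _ ⟩
    x * D (D y) - D (D x) * y ∎

  -- Divide out the gcd: with g = t a and h = t b, the Wronskian of g and h is t² times that of a
  -- and b. If the latter vanishes and u a + v b = 1, then D a and D b are a and b times u D a + v D
  -- b, so both are constant by `D-multiple`, and a h = b g.
  wronskian≈0⇒proportional : ∀ g h → g * D h - D g * h ≈ 0# →
    ¬ ¬ (Σ[ a ∈ Carrier ] Σ[ b ∈ Carrier ]
      Const a × Const b × ¬ (a ≈ 0# × b ≈ 0#) × (a * h ≈ b * g))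
  wronskian≈0⇒proportional g h w≈0 ¬goal =
    gcd g h λ (t , a , b , u , v , g≈ta , h≈tb , ua+vb≈1) →
    ¬¬-excluded-middle λ where
      -- If t vanishes, the quotients a and b say nothing about g and h; but h = 0, so the
      -- coefficients 1 and 0 work.
      (yes t≈0) → ¬goal (1# , 0# , D-1 , D-0 , (λ (1≈0 , _) → 1≉0 1≈0) ,
        trans (x*0 (trans h≈tb (0*x t≈0))) (sym (zeroˡ g)))
      (no t≉0) →
        let
          w′≈0 : a * D b - D a * b ≈ 0#
          w′≈0 = zero-product t≉0 (zero-product t≉0 (begin
            t * (t * (a * D b - D a * b))
              ≈⟨ solve 6 (λ t t′ a a′ b b′ →
                   t :* (t :* (a :* b′ :- a′ :* b)) :=
                   (t :* a) :* (t′ :* b :+ t :* b′) :- (t′ :* a :+ t :* a′) :* (t :* b))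
                   refl t (D t) a (D a) b (D b) ⟩
            (t * a) * (D t * b + t * D b) - (D t * a + t * D a) * (t * b)
              ≈⟨ +-cong (*-congˡ (D-* t b)) (-‿cong (*-congʳ (D-* t a))) ⟨
            (t * a) * D (t * b) - D (t * a) * (t * b)
              ≈⟨ +-cong (*-cong g≈ta (D-cong h≈tb)) (-‿cong (*-cong (D-cong g≈ta) h≈tb)) ⟨
            g * D h - D g * h
              ≈⟨ w≈0 ⟩
            0# ∎))
          Da≈ : D a ≈ a * (u * D a + v * D b)
          Da≈ = x-y≈0⇒x≈y (begin
            D a - a * (u * D a + v * D b)
              ≈⟨ +-congʳ (*-identityˡ (D a)) ⟨
            1# * D a - a * (u * D a + v * D b)
              ≈⟨ +-congʳ (*-congʳ ua+vb≈1) ⟨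
            (u * a + v * b) * D a - a * (u * D a + v * D b)
              ≈⟨ solve 6 (λ u v a a′ b b′ →
                   (u :* a :+ v :* b) :* a′ :- a :* (u :* a′ :+ v :* b′) :=
                   :- v :* (a :* b′ :- a′ :* b)) refl u v a (D a) b (D b) ⟩
            - v * (a * D b - D a * b)
              ≈⟨ x*0 w′≈0 ⟩
            0# ∎)
          Db≈ : D b ≈ b * (u * D a + v * D b)
          Db≈ = x-y≈0⇒x≈y (begin
            D b - b * (u * D a + v * D b)
              ≈⟨ +-congʳ (*-identityˡ (D b)) ⟨
            1# * D b - b * (u * D a + v * D b)
              ≈⟨ +-congʳ (*-congʳ ua+vb≈1) ⟨
            (u * a + v * b) * D b - b * (u * D a + v * D b)
              ≈⟨ solve 6 (λ u v a a′ b b′ →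
                   (u :* a :+ v :* b) :* b′ :- b :* (u :* a′ :+ v :* b′) :=
                   u :* (a :* b′ :- a′ :* b)) refl u v a (D a) b (D b) ⟩
            u * (a * D b - D a * b)
              ≈⟨ x*0 w′≈0 ⟩
            0# ∎)
        in ¬goal (a , b , D-multiple Da≈ , D-multiple Db≈ ,
          (λ (a≈0 , b≈0) → 1≉0 (trans (sym ua+vb≈1) (0+0 (x*0 a≈0) (x*0 b≈0)))) ,
          (begin
            a * h        ≈⟨ *-congˡ h≈tb ⟩
            a * (t * b)  ≈⟨ solve 3 (λ t a b → a :* (t :* b) := b :* (t :* a)) refl t a b ⟩
            b * (t * a)  ≈⟨ *-congˡ g≈ta ⟨
            b * g        ∎))

  -- Determinants and Wronskians of order three

  det : (x₀ x₁ x₂ y₀ y₁ y₂ z₀ z₁ z₂ : Carrier) → Carrier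
  det x₀ x₁ x₂ y₀ y₁ y₂ z₀ z₁ z₂ =
    x₀ * (y₁ * z₂ - y₂ * z₁) - x₁ * (y₀ * z₂ - y₂ * z₀) + x₂ * (y₀ * z₁ - y₁ * z₀)

  det-syntax : ∀ {n} (x₀ x₁ x₂ y₀ y₁ y₂ z₀ z₁ z₂ : Polynomial n) → Polynomial n
  det-syntax x₀ x₁ x₂ y₀ y₁ y₂ z₀ z₁ z₂ =
    x₀ :* (y₁ :* z₂ :- y₂ :* z₁) :- x₁ :* (y₀ :* z₂ :- y₂ :* z₀) :+ x₂ :* (y₀ :* z₁ :- y₁ :* z₀)

  wronskian₃ : (x y z : Carrier) → Carrier
  wronskian₃ x y z = det x (D x) (D (D x)) y (D y) (D (D y)) z (D z) (D (D z))

  minor-cong : ∀ {a b c d a′ b′ c′ d′} → a ≈ a′ → b ≈ b′ → c ≈ c′ → d ≈ d′ →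
    a * b - c * d ≈ a′ * b′ - c′ * d′
  minor-cong ha hb hc hd = +-cong (*-cong ha hb) (-‿cong (*-cong hc hd))

  det-cong : ∀ {x₀ x₁ x₂ y₀ y₁ y₂ z₀ z₁ z₂ x₀′ x₁′ x₂′ y₀′ y₁′ y₂′ z₀′ z₁′ z₂′} →
    x₀ ≈ x₀′ → x₁ ≈ x₁′ → x₂ ≈ x₂′ →
    y₀ ≈ y₀′ → y₁ ≈ y₁′ → y₂ ≈ y₂′ →
    z₀ ≈ z₀′ → z₁ ≈ z₁′ → z₂ ≈ z₂′ →
    det x₀ x₁ x₂ y₀ y₁ y₂ z₀ z₁ z₂ ≈ det x₀′ x₁′ x₂′ y₀′ y₁′ y₂′ z₀′ z₁′ z₂′
  det-cong hx₀ hx₁ hx₂ hy₀ hy₁ hy₂ hz₀ hz₁ hz₂ =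
    +-cong (+-cong (*-cong hx₀ (minor-cong hy₁ hz₂ hy₂ hz₁))
                   (-‿cong (*-cong hx₁ (minor-cong hy₀ hz₂ hy₂ hz₀))))
           (*-cong hx₂ (minor-cong hy₀ hz₁ hy₁ hz₀))

  det-scale : ∀ g h k a₀ a₁ a₂ b₀ b₁ b₂ c₀ c₁ c₂ →
    det (g * a₀) (g * a₁) (g * a₂) (h * b₀) (h * b₁) (h * b₂) (k * c₀) (k * c₁) (k * c₂)
      ≈ g * h * k * det a₀ a₁ a₂ b₀ b₁ b₂ c₀ c₁ c₂
  det-scale = solve 12 (λ g h k a₀ a₁ a₂ b₀ b₁ b₂ c₀ c₁ c₂ →
    det-syntax (g :* a₀) (g :* a₁) (g :* a₂) (h :* b₀) (h :* b₁) (h :* b₂)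
      (k :* c₀) (k :* c₁) (k :* c₂)
    := g :* h :* k :* det-syntax a₀ a₁ a₂ b₀ b₁ b₂ c₀ c₁ c₂) refl

  det-last≈0 : ∀ x₀ x₁ x₂ y₀ y₁ y₂ {z₀ z₁ z₂} → z₀ ≈ 0# → z₁ ≈ 0# → z₂ ≈ 0# →
    det x₀ x₁ x₂ y₀ y₁ y₂ z₀ z₁ z₂ ≈ 0#
  det-last≈0 x₀ x₁ x₂ y₀ y₁ y₂ h₀ h₁ h₂ =
    0+0 (0+0 (x*0 (minor≈0 h₂ h₁)) (neg0 (x*0 (minor≈0 h₂ h₀)))) (x*0 (minor≈0 h₁ h₀))
    where
    minor≈0 : ∀ {a b c d} → b ≈ 0# → d ≈ 0# → a * b - c * d ≈ 0#
    minor≈0 hb hd = 0+0 (x*0 hb) (neg0 (x*0 hd))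

  -- Reduction of order: the Wronskian of w(x,y) and w(x,z) carries the order-three Wronskian with
  -- the extra factor x. This makes the statement on two elements applicable to three.
  D-wronskian₃ : ∀ x y z →
    (x * D y - D x * y) * D (x * D z - D x * z)
      - D (x * D y - D x * y) * (x * D z - D x * z)
    ≈ x * wronskian₃ x y z
  D-wronskian₃ x y z = begin
    (x * D y - D x * y) * D (x * D z - D x * z)
      - D (x * D y - D x * y) * (x * D z - D x * z)
      ≈⟨ +-cong (*-congˡ (D-wronskian x z)) (-‿cong (*-congʳ (D-wronskian x y))) ⟩
    (x * D y - D x * y) * (x * D (D z) - D (D x) * z)
      - (x * D (D y) - D (D x) * y) * (x * D z - D x * z)
      ≈⟨ solve 9 (λ x x′ x″ y y′ y″ z z′ z″ →
           (x :* y′ :- x′ :* y) :* (x :* z″ :- x″ :* z)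
             :- (x :* y″ :- x″ :* y) :* (x :* z′ :- x′ :* z)
           := x :* det-syntax x x′ x″ y y′ y″ z z′ z″)
           refl x (D x) (D (D x)) y (D y) (D (D y)) z (D z) (D (D z)) ⟩
    x * wronskian₃ x y z ∎

  -- Proportionality is used twice. First a w(x,z) = b w(x,y) with constants a and b; since these
  -- are constant, it says that x and a z - b y have Wronskian zero. Hence a′ (a z - b y) = b′ x.
  -- The relation is nontrivial: if a′ = 0 then b′ is nonzero, and otherwise a′ a or a′ b is
  -- nonzero.
  wronskian₃≈0⇒dependent : ∀ x y z → wronskian₃ x y z ≈ 0# →
    ¬ ¬ (Σ[ α ∈ Carrier ] Σ[ β ∈ Carrier ] Σ[ γ ∈ Carrier ]
      Const α × Const β × Const γ × ¬ (α ≈ 0# × β ≈ 0# × γ ≈ 0#)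
      × (α * x + β * y + γ * z ≈ 0#))
  wronskian₃≈0⇒dependent x y z W≈0 ¬goal =
    wronskian≈0⇒proportional (x * D y - D x * y) (x * D z - D x * z)
      (trans (D-wronskian₃ x y z) (x*0 W≈0))
    λ (a , b , ca , cb , ab≉0 , a*w₁₃≈b*w₁₂) →
    wronskian≈0⇒proportional x (a * z - b * y) (begin
      x * D (a * z - b * y) - D x * (a * z - b * y)
        ≈⟨ +-congʳ (*-congˡ (trans (D-minus _ _)
             (+-cong (D-scale ca z) (-‿cong (D-scale cb y))))) ⟩
      x * (a * D z - b * D y) - D x * (a * z - b * y)
        ≈⟨ solve 8 (λ a b x x′ y y′ z z′ →
             x :* (a :* z′ :- b :* y′) :- x′ :* (a :* z :- b :* y)
             := a :* (x :* z′ :- x′ :* z) :- b :* (x :* y′ :- x′ :* y))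
             refl a b x (D x) y (D y) z (D z) ⟩
      a * (x * D z - D x * z) - b * (x * D y - D x * y)
        ≈⟨ x≈y⇒x-y≈0 a*w₁₃≈b*w₁₂ ⟩
      0# ∎)
    λ (a′ , b′ , ca′ , cb′ , a′b′≉0 , eq) →
    ¬goal (- b′ , - (a′ * b) , a′ * a
      , const-neg cb′ , const-neg (const-* ca′ cb) , const-* ca′ ca
      , (λ (-b′≈0 , -a′b≈0 , a′a≈0) → ¬¬-excluded-middle λ where
          (yes a′≈0) → a′b′≉0 (a′≈0 , neg≈0 -b′≈0)
          (no a′≉0) → ab≉0 (zero-product a′≉0 a′a≈0 , zero-product a′≉0 (neg≈0 -a′b≈0)))
      , (begin
          - b′ * x + - (a′ * b) * y + a′ * a * z
            ≈⟨ solve 7 (λ a b a′ b′ x y z →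
                 :- b′ :* x :+ :- (a′ :* b) :* y :+ a′ :* a :* z
                 := a′ :* (a :* z :- b :* y) :- b′ :* x) refl a b a′ b′ x y z ⟩
          a′ * (a * z - b * y) - b′ * x
            ≈⟨ x≈y⇒x-y≈0 eq ⟩
          0# ∎))
    where
    neg≈0 : ∀ {x} → - x ≈ 0# → x ≈ 0#
    neg≈0 {x} h = trans (solve 1 (λ x → x := :- (:- x)) refl x) (neg0 h)

  -- Degree bounds and derivatives of powers

  Deg≤-minus : ∀ {x y d} → Deg≤ x d → Deg≤ y d → Deg≤ (x - y) d
  Deg≤-minus hx hy = Deg≤-+ hx (Deg≤-neg hy)

  Deg≤-minor : ∀ {a b c e i j} → Deg≤ a i → Deg≤ b j → Deg≤ c i → Deg≤ e j →
    Deg≤ (a * b - c * e) (i ℕ.+ j)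
  Deg≤-minor ha hb hc he = Deg≤-minus (Deg≤-* ha hb) (Deg≤-* hc he)

  -- Differentiation gets no credit for lowering the degree; this coarse bound is what the degree
  -- counts below work with.
  Deg≤-wronskian : ∀ {x y i j} → Deg≤ x i → Deg≤ y j → Deg≤ (x * D y - D x * y) (i ℕ.+ j)
  Deg≤-wronskian hx hy = Deg≤-minor hx (Deg≤-D hy) (Deg≤-D hx) hy

  Deg≤-wronskian₃ : ∀ {x y z i j k} → Deg≤ x i → Deg≤ y j → Deg≤ z k →
    Deg≤ (wronskian₃ x y z) (i ℕ.+ (j ℕ.+ k))
  Deg≤-wronskian₃ hx hy hz =
    Deg≤-+ (Deg≤-minus (Deg≤-* hx (Deg≤-minor hy′ hz″ hy″ hz′))
                       (Deg≤-* hx′ (Deg≤-minor hy hz″ hy″ hz)))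
           (Deg≤-* hx″ (Deg≤-minor hy hz′ hy′ hz))
    where
    hx′ = Deg≤-D hx
    hx″ = Deg≤-D hx′
    hy′ = Deg≤-D hy
    hy″ = Deg≤-D hy′
    hz′ = Deg≤-D hz
    hz″ = Deg≤-D hz′

  Deg-^ : ∀ {p d} → Deg p d → ∀ n → Deg (p ^ n) (n ℕ.* d)
  Deg-^ hp zero    = Deg-1
  Deg-^ hp (suc n) = Deg-* hp (Deg-^ hp n)

  Deg0⇒const-^ : ∀ {p} → Deg p 0 → ∀ n → Const (p ^ n)
  Deg0⇒const-^ hp n = Deg≤0⇒D≈0
    (≡.subst (Deg≤ _) (ℕ.*-zeroʳ n) (Deg⇒Deg≤ (Deg-^ hp n)))

  -- Only the power of p that divides the derivative matters, so the cofactor is whatever the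
  -- product rule leaves behind.
  D-^ : ∀ p m → ∃ λ b → D (p ^ suc m) ≈ p ^ m * b
  D-^ p zero    = D (p * 1#) , sym (*-identityˡ _)
  D-^ p (suc m) = let b , h = D-^ p m in D p + b , (begin
    D (p * p ^ suc m)                       ≈⟨ D-* _ _ ⟩
    D p * p ^ suc m + p * D (p ^ suc m)     ≈⟨ +-congˡ (*-congˡ h) ⟩
    D p * (p * p ^ m) + p * (p ^ m * b)
      ≈⟨ solve 4 (λ p p′ g b → p′ :* (p :* g) :+ p :* (g :* b) := p :* g :* (p′ :+ b))
           refl p (D p) (p ^ m) b ⟩
    p * p ^ m * (D p + b) ∎)

  D²-^ : ∀ p m → ∃ λ b → D (D (p ^ suc (suc m))) ≈ p ^ m * b
  D²-^ p m = let b , h = D-^ p (suc m) ; b′ , h′ = D-^ p m in b′ * b + p * D b , (begin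
    D (D (p ^ suc (suc m)))               ≈⟨ D-cong h ⟩
    D (p ^ suc m * b)                     ≈⟨ D-* _ _ ⟩
    D (p ^ suc m) * b + p ^ suc m * D b   ≈⟨ +-congʳ (*-congʳ h′) ⟩
    p ^ m * b′ * b + p * p ^ m * D b
      ≈⟨ solve 5 (λ p g b b₁ b′ → g :* b′ :* b :+ p :* g :* b₁ := g :* (b′ :* b :+ p :* b₁))
           refl p (p ^ m) b (D b) b′ ⟩
    p ^ m * (b′ * b + p * D b) ∎)

  x≈0⇒x^suc≈0 : ∀ {p} → p ≈ 0# → ∀ m → p ^ suc m ≈ 0#
  x≈0⇒x^suc≈0 h m = 0*x h

  -- Each degree occurs in two of the three right-hand sides, so the sum of the inequalities is 3 (m
  -- S + e) ≤ 2 n S with S = x + y + z. For m = 3 + k and n = 4 + k this leaves (k + 1) S + 3 e ≤ 0.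
  three-degrees : ∀ k x y z e → let m = 3 ℕ.+ k ; n = 4 ℕ.+ k in
    m ℕ.* x ℕ.+ m ℕ.* y ℕ.+ m ℕ.* z ℕ.+ e ℕ.≤ n ℕ.* x ℕ.+ n ℕ.* y →
    m ℕ.* x ℕ.+ m ℕ.* y ℕ.+ m ℕ.* z ℕ.+ e ℕ.≤ n ℕ.* x ℕ.+ n ℕ.* z →
    m ℕ.* x ℕ.+ m ℕ.* y ℕ.+ m ℕ.* z ℕ.+ e ℕ.≤ n ℕ.* y ℕ.+ n ℕ.* z →
    x ℕ.+ y ℕ.+ z ≡ 0
  three-degrees k x y z e h₁ h₂ h₃ = ℕ.n≤0⇒n≡0 (ℕ.m+n≤o⇒m≤o S (ℕ.+-cancelˡ-≤ C (S ℕ.+ r) 0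
    (≡.subst₂ ℕ._≤_ lhs rhs (ℕ.+-mono-≤ (ℕ.+-mono-≤ h₁ h₂) h₃))))
    where
    open ℕ-Solver using ()
      renaming (solve to solveℕ; _:+_ to _⊞_; _:*_ to _⊠_; _:=_ to _≗_; con to #)
    S = x ℕ.+ y ℕ.+ z
    r = k ℕ.* S ℕ.+ 3 ℕ.* e
    m = 3 ℕ.+ k
    n = 4 ℕ.+ k
    C = 2 ℕ.* (n ℕ.* S)
    l = m ℕ.* x ℕ.+ m ℕ.* y ℕ.+ m ℕ.* z ℕ.+ e
    lhs : l ℕ.+ l ℕ.+ l ≡ C ℕ.+ (S ℕ.+ r)
    lhs = solveℕ 5 (λ k x y z e →
      let m = # 3 ⊞ k ; n = # 4 ⊞ k ; S = x ⊞ y ⊞ z ; l = m ⊠ x ⊞ m ⊠ y ⊞ m ⊠ z ⊞ e in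
      l ⊞ l ⊞ l ≗ # 2 ⊠ (n ⊠ S) ⊞ (S ⊞ (k ⊠ S ⊞ # 3 ⊠ e))) ≡.refl k x y z e
    rhs : (n ℕ.* x ℕ.+ n ℕ.* y) ℕ.+ (n ℕ.* x ℕ.+ n ℕ.* z) ℕ.+ (n ℕ.* y ℕ.+ n ℕ.* z) ≡ C ℕ.+ 0
    rhs = solveℕ 4 (λ k x y z →
      let n = # 4 ⊞ k ; S = x ⊞ y ⊞ z in
      (n ⊠ x ⊞ n ⊠ y) ⊞ (n ⊠ x ⊞ n ⊠ z) ⊞ (n ⊠ y ⊞ n ⊠ z) ≗ # 2 ⊠ (n ⊠ S) ⊞ # 0)
      ≡.refl k x y z

  -- Each degree occurs in three of the four right-hand sides, so 4 (m S + e) ≤ 3 n S. For m = n - 2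
  -- this is (n - 8) S + 4 e ≤ 0, and n = 9 + k makes the coefficient k + 1.
  four-degrees : ∀ k x y z t e → let m = 7 ℕ.+ k ; n = 9 ℕ.+ k in
    let l = m ℕ.* x ℕ.+ m ℕ.* y ℕ.+ m ℕ.* z ℕ.+ m ℕ.* t ℕ.+ e in
    l ℕ.≤ n ℕ.* x ℕ.+ (n ℕ.* y ℕ.+ n ℕ.* z) →
    l ℕ.≤ n ℕ.* x ℕ.+ (n ℕ.* y ℕ.+ n ℕ.* t) →
    l ℕ.≤ n ℕ.* x ℕ.+ (n ℕ.* z ℕ.+ n ℕ.* t) →
    l ℕ.≤ n ℕ.* y ℕ.+ (n ℕ.* z ℕ.+ n ℕ.* t) →
    x ℕ.+ y ℕ.+ z ℕ.+ t ≡ 0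
  four-degrees k x y z t e h₁ h₂ h₃ h₄ =
    ℕ.n≤0⇒n≡0 (ℕ.m+n≤o⇒m≤o S (ℕ.+-cancelˡ-≤ C (S ℕ.+ r) 0
    (≡.subst₂ ℕ._≤_ lhs rhs (ℕ.+-mono-≤ (ℕ.+-mono-≤ (ℕ.+-mono-≤ h₁ h₂) h₃) h₄))))
    where
    open ℕ-Solver using ()
      renaming (solve to solveℕ; _:+_ to _⊞_; _:*_ to _⊠_; _:=_ to _≗_; con to #)
    S = x ℕ.+ y ℕ.+ z ℕ.+ t
    r = k ℕ.* S ℕ.+ 4 ℕ.* e
    m = 7 ℕ.+ k
    n = 9 ℕ.+ k
    C = 3 ℕ.* (n ℕ.* S)
    l = m ℕ.* x ℕ.+ m ℕ.* y ℕ.+ m ℕ.* z ℕ.+ m ℕ.* t ℕ.+ e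
    lhs : l ℕ.+ l ℕ.+ l ℕ.+ l ≡ C ℕ.+ (S ℕ.+ r)
    lhs = solveℕ 6 (λ k x y z t e →
      let m = # 7 ⊞ k ; n = # 9 ⊞ k ; S = x ⊞ y ⊞ z ⊞ t
          l = m ⊠ x ⊞ m ⊠ y ⊞ m ⊠ z ⊞ m ⊠ t ⊞ e in
      l ⊞ l ⊞ l ⊞ l ≗ # 3 ⊠ (n ⊠ S) ⊞ (S ⊞ (k ⊠ S ⊞ # 4 ⊠ e))) ≡.refl k x y z t e
    rhs : (n ℕ.* x ℕ.+ (n ℕ.* y ℕ.+ n ℕ.* z)) ℕ.+ (n ℕ.* x ℕ.+ (n ℕ.* y ℕ.+ n ℕ.* t))
      ℕ.+ (n ℕ.* x ℕ.+ (n ℕ.* z ℕ.+ n ℕ.* t)) ℕ.+ (n ℕ.* y ℕ.+ (n ℕ.* z ℕ.+ n ℕ.* t)) ≡ C ℕ.+ 0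
    rhs = solveℕ 5 (λ k x y z t →
      let n = # 9 ⊞ k ; S = x ⊞ y ⊞ z ⊞ t in
      (n ⊠ x ⊞ (n ⊠ y ⊞ n ⊠ z)) ⊞ (n ⊠ x ⊞ (n ⊠ y ⊞ n ⊠ t))
        ⊞ (n ⊠ x ⊞ (n ⊠ z ⊞ n ⊠ t)) ⊞ (n ⊠ y ⊞ (n ⊠ z ⊞ n ⊠ t)) ≗ # 3 ⊠ (n ⊠ S) ⊞ # 0)
      ≡.refl k x y z t

  -- Meant for P and Q the m-th powers of p and q, where `p * P` unfolds from `p ^ suc m`, and for
  -- x′ and y′ the derivatives of these larger powers.
  wronskian-factor : ∀ {p q P Q x′ y′ a b} → x′ ≈ P * a → y′ ≈ Q * b →
    (p * P) * y′ - x′ * (q * Q) ≈ P * Q * (p * b - a * q)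
  wronskian-factor {p} {q} {P} {Q} {a = a} {b} hx hy =
    trans (+-cong (*-congˡ hy) (-‿cong (*-congʳ hx)))
      (solve 6 (λ p q P Q a b → (p :* P) :* (Q :* b) :- (P :* a) :* (q :* Q)
        := P :* Q :* (p :* b :- a :* q)) refl p q P Q a b)

  -- Expand W = (u P + v Q + w R) W, using a different hypothesis in each summand.
  product-divides₃ : ∀ {W P Q R u v w e₁ e₂ e₃} → u * P + v * Q + w * R ≈ 1# →
    W ≈ Q * R * e₁ → W ≈ P * R * e₂ → W ≈ P * Q * e₃ →
    W ≈ P * Q * R * (u * e₁ + v * e₂ + w * e₃)
  product-divides₃ {W} {P} {Q} {R} {u} {v} {w} {e₁} {e₂} {e₃} bezout h₁ h₂ h₃ = begin
    W
      ≈⟨ *-identityˡ W ⟨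
    1# * W
      ≈⟨ *-congʳ bezout ⟨
    (u * P + v * Q + w * R) * W
      ≈⟨ solve 7 (λ W P Q R u v w → (u :* P :+ v :* Q :+ w :* R) :* W
           := u :* P :* W :+ v :* Q :* W :+ w :* R :* W) refl W P Q R u v w ⟩
    u * P * W + v * Q * W + w * R * W
      ≈⟨ +-cong (+-cong (*-congˡ h₁) (*-congˡ h₂)) (*-congˡ h₃) ⟩
    u * P * (Q * R * e₁) + v * Q * (P * R * e₂) + w * R * (P * Q * e₃)
      ≈⟨ solve 9 (λ P Q R u v w e₁ e₂ e₃ →
           u :* P :* (Q :* R :* e₁) :+ v :* Q :* (P :* R :* e₂) :+ w :* R :* (P :* Q :* e₃)
           := P :* Q :* R :* (u :* e₁ :+ v :* e₂ :+ w :* e₃)) refl P Q R u v w e₁ e₂ e₃ ⟩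
    P * Q * R * (u * e₁ + v * e₂ + w * e₃) ∎

  product-divides₄ : ∀ {W P Q R S u v w z e₁ e₂ e₃ e₄} →
    u * P + v * Q + w * R + z * S ≈ 1# →
    W ≈ Q * R * S * e₁ → W ≈ P * R * S * e₂ → W ≈ P * Q * S * e₃ → W ≈ P * Q * R * e₄ →
    W ≈ P * Q * R * S * (u * e₁ + v * e₂ + w * e₃ + z * e₄)
  product-divides₄ {W} {P} {Q} {R} {S} {u} {v} {w} {z} {e₁} {e₂} {e₃} {e₄} bezout h₁ h₂ h₃ h₄ = begin
    W
      ≈⟨ *-identityˡ W ⟨
    1# * W
      ≈⟨ *-congʳ bezout ⟨
    (u * P + v * Q + w * R + z * S) * W
      ≈⟨ solve 9 (λ W P Q R S u v w z → (u :* P :+ v :* Q :+ w :* R :+ z :* S) :* W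
           := u :* P :* W :+ v :* Q :* W :+ w :* R :* W :+ z :* S :* W) refl W P Q R S u v w z ⟩
    u * P * W + v * Q * W + w * R * W + z * S * W
      ≈⟨ +-cong (+-cong (+-cong (*-congˡ h₁) (*-congˡ h₂)) (*-congˡ h₃)) (*-congˡ h₄) ⟩
    u * P * (Q * R * S * e₁) + v * Q * (P * R * S * e₂) + w * R * (P * Q * S * e₃)
      + z * S * (P * Q * R * e₄)
      ≈⟨ solve 12 (λ P Q R S u v w z e₁ e₂ e₃ e₄ →
           u :* P :* (Q :* R :* S :* e₁) :+ v :* Q :* (P :* R :* S :* e₂)
             :+ w :* R :* (P :* Q :* S :* e₃) :+ z :* S :* (P :* Q :* R :* e₄)
           := P :* Q :* R :* S :* (u :* e₁ :+ v :* e₂ :+ w :* e₃ :+ z :* e₄))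
           refl P Q R S u v w z e₁ e₂ e₃ e₄ ⟩
    P * Q * R * S * (u * e₁ + v * e₂ + w * e₃ + z * e₄) ∎

  -- When all 2×2 Wronskians vanish, x′ = (u x + v y + w z) x′ = x (u x′ + v y′ + w z′).
  wronskians≈0⇒const : ∀ {x y z u v w} → u * x + v * y + w * z ≈ 1# →
    x * D y - D x * y ≈ 0# → x * D z - D x * z ≈ 0# → Const x
  wronskians≈0⇒const {x} {y} {z} {u} {v} {w} bezout hxy hxz = D-multiple (x-y≈0⇒x≈y (begin
    D x - x * (u * D x + v * D y + w * D z)
      ≈⟨ +-congʳ (*-identityˡ (D x)) ⟨
    1# * D x - x * (u * D x + v * D y + w * D z)
      ≈⟨ +-congʳ (*-congʳ bezout) ⟨
    (u * x + v * y + w * z) * D x - x * (u * D x + v * D y + w * D z)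
      ≈⟨ solve 9 (λ u v w x x′ y y′ z z′ →
           (u :* x :+ v :* y :+ w :* z) :* x′ :- x :* (u :* x′ :+ v :* y′ :+ w :* z′)
           := :- v :* (x :* y′ :- x′ :* y) :- w :* (x :* z′ :- x′ :* z))
           refl u v w x (D x) y (D y) z (D z) ⟩
    - v * (x * D y - D x * y) - w * (x * D z - D x * z)
      ≈⟨ 0+0 (x*0 hxy) (neg0 (x*0 hxz)) ⟩
    0# ∎))

  factor≉0 : ∀ {x y z} → x ≈ y * z → ¬ (x ≈ 0#) → ¬ (y ≈ 0#)
  factor≉0 h x≉0 y≈0 = x≉0 (trans h (0*x y≈0))

  -- Linear relations between three powers

  module ThreeTerms (k : ℕ) {α β γ p q r u v w : Carrier} where

    m n : ℕ
    m = 3 ℕ.+ k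
    n = suc m

    -- The relation and its derivative are two linear equations for (α, β, γ), so the 2×2 minors are
    -- proportional to the coefficients; suitably weighted, the three Wronskians share the value
    -- `W`. If `W` vanishes, all three Wronskians do, because the coefficients do not, and Bézout
    -- makes each power constant. Otherwise the degree count applies.
    three-terms :
      Const α → Const β → Const γ → ¬ (α ≈ 0#) → ¬ (β ≈ 0#) → ¬ (γ ≈ 0#) →
      α * p ^ n + β * q ^ n + γ * r ^ n ≈ 0# →
      u * p ^ n + v * q ^ n + w * r ^ n ≈ 1# →
      Const (p ^ n) × Const (q ^ n) × Const (r ^ n)
    three-terms cα cβ cγ α≉0 β≉0 γ≉0 relation bezout =
      const-p , const-q , const-r
      where
      F = p ^ n
      G = q ^ n
      H = r ^ n
      P = p ^ m
      Q = q ^ m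
      R = r ^ m
      a = proj₁ (D-^ p m)
      b = proj₁ (D-^ q m)
      c′ = proj₁ (D-^ r m)
      hF : D F ≈ P * a
      hF = proj₂ (D-^ p m)
      hG : D G ≈ Q * b
      hG = proj₂ (D-^ q m)
      hH : D H ≈ R * c′
      hH = proj₂ (D-^ r m)

      wFG = F * D G - D F * G
      wFH = F * D H - D F * H
      wGH = G * D H - D G * H
      W = α * β * wFG

      D-relation : α * D F + β * D G + γ * D H ≈ 0#
      D-relation = begin
        α * D F + β * D G + γ * D H
          ≈⟨ +-cong (+-cong (D-scale cα F) (D-scale cβ G)) (D-scale cγ H) ⟨
        D (α * F) + D (β * G) + D (γ * H)
          ≈⟨ trans (D-+ _ _) (+-congʳ (D-+ _ _)) ⟨
        D (α * F + β * G + γ * H)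
          ≈⟨ D-cong relation ⟩
        D 0#
          ≈⟨ D-0 ⟩
        0# ∎

      W≈FH : W ≈ - (α * γ) * wFH
      W≈FH = x-y≈0⇒x≈y (begin
        W - - (α * γ) * wFH
          ≈⟨ solve 9 (λ α β γ F F′ G G′ H H′ →
               α :* β :* (F :* G′ :- F′ :* G) :- :- (α :* γ) :* (F :* H′ :- F′ :* H)
               := α :* F :* (α :* F′ :+ β :* G′ :+ γ :* H′)
                 :- α :* F′ :* (α :* F :+ β :* G :+ γ :* H))
               refl α β γ F (D F) G (D G) H (D H) ⟩
        α * F * (α * D F + β * D G + γ * D H) - α * D F * (α * F + β * G + γ * H)
          ≈⟨ 0+0 (x*0 D-relation) (neg0 (x*0 relation)) ⟩
        0# ∎)

      W≈GH : W ≈ β * γ * wGH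
      W≈GH = x-y≈0⇒x≈y (begin
        W - β * γ * wGH
          ≈⟨ solve 9 (λ α β γ F F′ G G′ H H′ →
               α :* β :* (F :* G′ :- F′ :* G) :- β :* γ :* (G :* H′ :- G′ :* H)
               := β :* G′ :* (α :* F :+ β :* G :+ γ :* H)
                 :- β :* G :* (α :* F′ :+ β :* G′ :+ γ :* H′))
               refl α β γ F (D F) G (D G) H (D H) ⟩
        β * D G * (α * F + β * G + γ * H) - β * G * (α * D F + β * D G + γ * D H)
          ≈⟨ 0+0 (x*0 relation) (neg0 (x*0 D-relation)) ⟩
        0# ∎)

      factor : ∀ {s X Y e t} → t ≈ X * Y * e → s * t ≈ X * Y * (s * e)
      factor {s} {X} {Y} {e} h = trans (*-congˡ h)
        (solve 4 (λ s X Y e → s :* (X :* Y :* e) := X :* Y :* (s :* e)) refl s X Y e)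

      E : Carrier
      E = u * p * (β * γ * (q * c′ - b * r))
        + v * q * (- (α * γ) * (p * c′ - a * r))
        + w * r * (α * β * (p * b - a * q))

      -- Bézout is given for the n-th powers, while `W` is divisible by products of m-th powers; the
      -- surplus factors p, q, r move into the coefficients.
      bezout′ : u * p * P + v * q * Q + w * r * R ≈ 1#
      bezout′ = trans (+-cong (+-cong (*-assoc _ _ _) (*-assoc _ _ _)) (*-assoc _ _ _)) bezout

      W≈PQRE : W ≈ P * Q * R * E
      W≈PQRE = product-divides₃ bezout′
        (trans W≈GH (factor (wronskian-factor hG hH)))
        (trans W≈FH (factor (wronskian-factor hF hH)))
        (factor (wronskian-factor hF hG))

      all-const : ¬ (W ≈ 0#) → ¬ ¬ (Const F × Const G × Const H)
      all-const W≉0 ¬goal =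
        Deg-exists p≉0 λ (d₁ , hp) →
        Deg-exists q≉0 λ (d₂ , hq) →
        Deg-exists r≉0 λ (d₃ , hr) →
        Deg-exists E≉0 λ (e , hE) →
        let
          degW = Deg-* (Deg-* (Deg-* (Deg-^ hp m) (Deg-^ hq m)) (Deg-^ hr m)) hE
          bound : ∀ {s x y i j} → Const s → Deg x i → Deg y j →
            W ≈ s * (x ^ n * D (y ^ n) - D (x ^ n) * y ^ n) →
            m ℕ.* d₁ ℕ.+ m ℕ.* d₂ ℕ.+ m ℕ.* d₃ ℕ.+ e ℕ.≤ n ℕ.* i ℕ.+ n ℕ.* j
          bound cs hx hy W≈ = Deg-least degW (Deg≤-cong (trans (sym W≈) W≈PQRE)
            -- The constant coefficient contributes degree 0, and the sum with 0 reduces, so the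
            -- bound is that of the bare Wronskian.
            (Deg≤-* (D≈0⇒Deg≤0 cs)
              (Deg≤-wronskian (Deg⇒Deg≤ (Deg-^ hx n)) (Deg⇒Deg≤ (Deg-^ hy n)))))
          S≡0 = three-degrees k d₁ d₂ d₃ e
            (bound (const-* cα cβ) hp hq refl)
            (bound (const-neg (const-* cα cγ)) hp hr W≈FH)
            (bound (const-* cβ cγ) hq hr W≈GH)
          d₁₂≡0 = ℕ.m+n≡0⇒m≡0 (d₁ ℕ.+ d₂) S≡0
        in ¬goal
          ( Deg0⇒const-^ (≡.subst (Deg p) (ℕ.m+n≡0⇒m≡0 d₁ d₁₂≡0) hp) n
          , Deg0⇒const-^ (≡.subst (Deg q) (ℕ.m+n≡0⇒n≡0 d₁ d₁₂≡0) hq) n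
          , Deg0⇒const-^ (≡.subst (Deg r) (ℕ.m+n≡0⇒n≡0 (d₁ ℕ.+ d₂) S≡0) hr) n)
        where
        E≉0 : ¬ (E ≈ 0#)
        E≉0 h = W≉0 (trans W≈PQRE (x*0 h))
        PQ≉0 : ¬ (P * Q ≈ 0#)
        PQ≉0 h = W≉0 (trans W≈PQRE (0*x (0*x h)))
        p≉0 : ¬ (p ≈ 0#)
        p≉0 h = PQ≉0 (0*x (0*x h))
        q≉0 : ¬ (q ≈ 0#)
        q≉0 h = PQ≉0 (x*0 (0*x h))
        r≉0 : ¬ (r ≈ 0#)
        r≉0 h = W≉0 (trans W≈PQRE (0*x (x*0 (0*x h))))

      module _ (W≈0 : W ≈ 0#) where
        wFG≈0 : wFG ≈ 0#
        wFG≈0 = zero-product (≉-* α≉0 β≉0) W≈0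
        wFH≈0 : wFH ≈ 0#
        wFH≈0 = zero-product (≉-neg (≉-* α≉0 γ≉0)) (trans (sym W≈FH) W≈0)
        wGH≈0 : wGH ≈ 0#
        wGH≈0 = zero-product (≉-* β≉0 γ≉0) (trans (sym W≈GH) W≈0)

      swap : ∀ {x y} → x * D y - D x * y ≈ 0# → y * D x - D y * x ≈ 0#
      swap {x} {y} h = trans
        (solve 4 (λ x x′ y y′ → y :* x′ :- y′ :* x := :- (x :* y′ :- x′ :* y)) refl x (D x) y (D y))
        (neg0 h)

      const-p : Const F
      const-p = by-cases {A = W ≈ 0#}
        (λ h → wronskians≈0⇒const bezout (wFG≈0 h) (wFH≈0 h))
        (λ h → stable λ ¬c → all-const h λ (c , _) → ¬c c)

      const-q : Const G
      const-q = by-cases {A = W ≈ 0#}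
        (λ h → wronskians≈0⇒const
          (trans (+-congʳ (+-comm _ _)) bezout) (swap (wFG≈0 h)) (wGH≈0 h))
        (λ h → stable λ ¬c → all-const h λ (_ , c , _) → ¬c c)

      const-r : Const H
      const-r = by-cases {A = W ≈ 0#}
        (λ h → wronskians≈0⇒const
          (trans (trans (+-assoc _ _ _) (+-comm _ _)) bezout)
          (swap (wFH≈0 h)) (swap (wGH≈0 h)))
        (λ h → stable λ ¬c → all-const h λ (_ , _ , c) → ¬c c)

  -- Equal sums of two powers

  module EqualSums (j : ℕ) {p q r s : Carrier} where

    m n : ℕ
    m = 14 ℕ.+ j
    n = 16 ℕ.+ j

    private
      F = p ^ n
      G = q ^ n
      H = r ^ n
      K = s ^ n

    record Hypotheses : Set (c ⊔ ℓ) where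
      field
        equation : F + G ≈ H + K
        {u v w z} : Carrier
        bezout   : u * F + v * G + w * H + z * K ≈ 1#

    module _ (hypotheses : Hypotheses) where
      open Hypotheses hypotheses

      relation₀ : F + G - H - K ≈ 0#
      relation₀ = begin
        F + G - H - K      ≈⟨ solve 4 (λ F G H K → F :+ G :- H :- K := (F :+ G) :- (H :+ K)) refl F G H K ⟩
        (F + G) - (H + K)  ≈⟨ x≈y⇒x-y≈0 equation ⟩
        0#                 ∎

      D-relation : ∀ {x y z t} → x + y - z - t ≈ 0# → D x + D y - D z - D t ≈ 0#
      D-relation {x} {y} {z} {t} h = begin
        D x + D y - D z - D t    ≈⟨ +-congʳ (+-congʳ (D-+ x y)) ⟨
        D (x + y) - D z - D t    ≈⟨ +-congʳ (D-minus (x + y) z) ⟨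
        D (x + y - z) - D t      ≈⟨ D-minus (x + y - z) t ⟨
        D (x + y - z - t)        ≈⟨ D-cong h ⟩
        D 0#                     ≈⟨ D-0 ⟩
        0#                       ∎

      relation₁ = D-relation relation₀
      relation₂ = D-relation relation₁

      W : Carrier
      W = wronskian₃ F G H

      -- By multilinearity, the two Wronskians add up to minus the determinant with rows F, G and F
      -- + G - H - K: repeated rows contribute nothing. The last row vanishes together with its
      -- derivatives. The next two identities arise in the same way.
      W≈-FGK : W ≈ - wronskian₃ F G K
      W≈-FGK = x-y≈0⇒x≈y (trans
        (solve 12 (λ a a′ a″ b b′ b″ c c′ c″ d d′ d″ →
          det-syntax a a′ a″ b b′ b″ c c′ c″ :- :- det-syntax a a′ a″ b b′ b″ d d′ d″
          := :- det-syntax a a′ a″ b b′ b″ (a :+ b :- c :- d) (a′ :+ b′ :- c′ :- d′) (a″ :+ b″ :- c″ :- d″))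
          refl F (D F) (D (D F)) G (D G) (D (D G)) H (D H) (D (D H)) K (D K) (D (D K)))
        (neg0 (det-last≈0 _ _ _ _ _ _ relation₀ relation₁ relation₂)))

      W≈-FHK : W ≈ - wronskian₃ F H K
      W≈-FHK = x-y≈0⇒x≈y (trans
        (solve 12 (λ a a′ a″ b b′ b″ c c′ c″ d d′ d″ →
          det-syntax a a′ a″ b b′ b″ c c′ c″ :- :- det-syntax a a′ a″ c c′ c″ d d′ d″
          := :- det-syntax a a′ a″ c c′ c″ (a :+ b :- c :- d) (a′ :+ b′ :- c′ :- d′) (a″ :+ b″ :- c″ :- d″))
          refl F (D F) (D (D F)) G (D G) (D (D G)) H (D H) (D (D H)) K (D K) (D (D K)))
        (neg0 (det-last≈0 _ _ _ _ _ _ relation₀ relation₁ relation₂)))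

      W≈GHK : W ≈ wronskian₃ G H K
      W≈GHK = x-y≈0⇒x≈y (trans
        (solve 12 (λ a a′ a″ b b′ b″ c c′ c″ d d′ d″ →
          det-syntax a a′ a″ b b′ b″ c c′ c″ :- det-syntax b b′ b″ c c′ c″ d d′ d″
          := det-syntax b b′ b″ c c′ c″ (a :+ b :- c :- d) (a′ :+ b′ :- c′ :- d′) (a″ :+ b″ :- c″ :- d″))
          refl F (D F) (D (D F)) G (D G) (D (D G)) H (D H) (D (D H)) K (D K) (D (D K)))
        (det-last≈0 _ _ _ _ _ _ relation₀ relation₁ relation₂))

      -- A power and its first two derivatives share the factor with exponent m = n - 2, since each
      -- derivative costs one factor. Hence this power comes out of the whole row of the
      -- determinant.
      wronskian₃-^ : ∀ x y t → ∃ λ e →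
        wronskian₃ (x ^ n) (y ^ n) (t ^ n) ≈ x ^ m * y ^ m * t ^ m * e
      wronskian₃-^ x y t =
        let a₁ , hx₁ = divides₁ x ; a₂ , hx₂ = D²-^ x m
            b₁ , hy₁ = divides₁ y ; b₂ , hy₂ = D²-^ y m
            c₁ , ht₁ = divides₁ t ; c₂ , ht₂ = D²-^ t m
        in _ , trans
          (det-cong (divides₀ x) hx₁ hx₂ (divides₀ y) hy₁ hy₂ (divides₀ t) ht₁ ht₂)
          (det-scale (x ^ m) (y ^ m) (t ^ m) (x * x) a₁ a₂ (y * y) b₁ b₂ (t * t) c₁ c₂)
        where
        divides₀ : ∀ x → x ^ n ≈ x ^ m * (x * x)
        divides₀ x = solve 2 (λ x g → x :* (x :* g) := g :* (x :* x)) refl x (x ^ m)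
        divides₁ : ∀ x → ∃ λ a → D (x ^ n) ≈ x ^ m * a
        divides₁ x = let b , h = D-^ x (suc m) in x * b , trans h
          (solve 3 (λ x g b → x :* g :* b := g :* (x :* b)) refl x (x ^ m) b)

      W-multiple : ∃ λ e → W ≈ p ^ m * q ^ m * r ^ m * s ^ m * e
      W-multiple = _ , product-divides₄
        -- The coefficients absorb the squares of p, q, r, s, turning Bézout for n-th powers into
        -- Bézout for m-th powers.
        (trans (+-cong (+-cong (+-cong (split u p) (split v q)) (split w r)) (split z s)) bezout)
        (trans W≈GHK (proj₂ (wronskian₃-^ q r s)))
        (trans W≈-FHK (negated (proj₂ (wronskian₃-^ p r s))))
        (trans W≈-FGK (negated (proj₂ (wronskian₃-^ p q s))))
        (proj₂ (wronskian₃-^ p q r))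
        where
        split : ∀ u x → u * (x * x) * x ^ m ≈ u * x ^ n
        split u x = solve 3 (λ u x g → u :* (x :* x) :* g := u :* (x :* (x :* g))) refl u x (x ^ m)
        negated : ∀ {x P e} → x ≈ P * e → - x ≈ P * - e
        negated {x} {P} {e} h = trans (-‿cong h)
          (solve 2 (λ P e → :- (P :* e) := P :* (:- e)) refl P e)

      AllConst : Set ℓ
      AllConst = Const F × Const G × Const H × Const K

      W≉0⇒all-const : ¬ (W ≈ 0#) → ¬ ¬ AllConst
      W≉0⇒all-const W≉0 ¬goal =
        Deg-exists p≉0 λ (d₁ , hp) →
        Deg-exists q≉0 λ (d₂ , hq) →
        Deg-exists r≉0 λ (d₃ , hr) →
        Deg-exists s≉0 λ (d₄ , hs) →
        Deg-exists E≉0 λ (e , hE) →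
        let
          degW = Deg-* (Deg-* (Deg-* (Deg-* (Deg-^ hp m) (Deg-^ hq m)) (Deg-^ hr m)) (Deg-^ hs m)) hE
          bound : ∀ {f d} → W ≈ f → Deg≤ f d →
            m ℕ.* d₁ ℕ.+ m ℕ.* d₂ ℕ.+ m ℕ.* d₃ ℕ.+ m ℕ.* d₄ ℕ.+ e ℕ.≤ d
          bound W≈ hf = Deg-least degW (Deg≤-cong (trans (sym W≈) W≈E) hf)
          deg≤ : ∀ {x d} → Deg x d → Deg≤ (x ^ n) (n ℕ.* d)
          deg≤ hx = Deg⇒Deg≤ (Deg-^ hx n)
          -- The exponents 7 + k and 9 + k of the count become m = 14 + j and n = 16 + j at k = 7 +
          -- j.
          S≡0 = four-degrees (7 ℕ.+ j) d₁ d₂ d₃ d₄ e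
            (bound refl (Deg≤-wronskian₃ (deg≤ hp) (deg≤ hq) (deg≤ hr)))
            (bound W≈-FGK (Deg≤-neg (Deg≤-wronskian₃ (deg≤ hp) (deg≤ hq) (deg≤ hs))))
            (bound W≈-FHK (Deg≤-neg (Deg≤-wronskian₃ (deg≤ hp) (deg≤ hr) (deg≤ hs))))
            (bound W≈GHK (Deg≤-wronskian₃ (deg≤ hq) (deg≤ hr) (deg≤ hs)))
          d₁₂₃≡0 = ℕ.m+n≡0⇒m≡0 (d₁ ℕ.+ d₂ ℕ.+ d₃) S≡0
          d₁₂≡0 = ℕ.m+n≡0⇒m≡0 (d₁ ℕ.+ d₂) d₁₂₃≡0
        in ¬goal
          ( Deg0⇒const-^ (≡.subst (Deg p) (ℕ.m+n≡0⇒m≡0 d₁ d₁₂≡0) hp) n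
          , Deg0⇒const-^ (≡.subst (Deg q) (ℕ.m+n≡0⇒n≡0 d₁ d₁₂≡0) hq) n
          , Deg0⇒const-^ (≡.subst (Deg r) (ℕ.m+n≡0⇒n≡0 (d₁ ℕ.+ d₂) d₁₂₃≡0) hr) n
          , Deg0⇒const-^ (≡.subst (Deg s) (ℕ.m+n≡0⇒n≡0 (d₁ ℕ.+ d₂ ℕ.+ d₃) S≡0) hs) n)
        where
        E = proj₁ W-multiple
        W≈E = proj₂ W-multiple
        E≉0 : ¬ (E ≈ 0#)
        E≉0 h = W≉0 (trans W≈E (x*0 h))
        PQRS≉0 = factor≉0 W≈E W≉0
        p≉0 : ¬ (p ≈ 0#)
        p≉0 h = PQRS≉0 (0*x (0*x (0*x (0*x h))))
        q≉0 : ¬ (q ≈ 0#)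
        q≉0 h = PQRS≉0 (0*x (0*x (x*0 (0*x h))))
        r≉0 : ¬ (r ≈ 0#)
        r≉0 h = PQRS≉0 (0*x (x*0 (0*x h)))
        s≉0 : ¬ (s ≈ 0#)
        s≉0 h = PQRS≉0 (x*0 (0*x h))

      const-K : Const F → Const G → Const H → Const K
      const-K cF cG cH = const-of-equal
        (trans (+-congʳ equation) (solve 2 (λ H K → (H :+ K) :- H := K) refl H K))
        (const-+ (const-+ cF cG) (const-neg cH))

      const-H : Const F → Const G → Const K → Const H
      const-H cF cG cK = const-of-equal
        (trans (+-congʳ equation) (solve 2 (λ H K → (H :+ K) :- K := H) refl H K))
        (const-+ (const-+ cF cG) (const-neg cK))

      const-G : Const F → Const H → Const K → Const G
      const-G cF cH cK = const-of-equal
        (trans (+-congʳ (sym equation)) (solve 2 (λ F G → (F :+ G) :- F := G) refl F G))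
        (const-+ (const-+ cH cK) (const-neg cF))

      const-F : Const G → Const H → Const K → Const F
      const-F cG cH cK = const-of-equal
        (trans (+-congʳ (sym equation)) (solve 2 (λ F G → (F :+ G) :- G := F) refl F G))
        (const-+ (const-+ cH cK) (const-neg cG))

      -- A Bézout sum may be changed by any multiple of F + G - H - K. The right multiple cancels
      -- one chosen power, so any three of the four powers generate the unit ideal.
      bezout-with : ∀ {X x} → x * (F + G - H - K) + X ≈ u * F + v * G + w * H + z * K → X ≈ 1#
      bezout-with {X} {x} h = begin
        X                          ≈⟨ +-identityˡ X ⟨
        0# + X                     ≈⟨ +-congʳ (x*0 relation₀) ⟨
        x * (F + G - H - K) + X    ≈⟨ h ⟩
        u * F + v * G + w * H + z * K  ≈⟨ bezout ⟩
        1#                         ∎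

      bezout-FGH : (u + z) * F + (v + z) * G + (w - z) * H ≈ 1#
      bezout-FGH = bezout-with {x = - z} (solve 8 (λ u v w z F G H K →
        :- z :* (F :+ G :- H :- K) :+ ((u :+ z) :* F :+ (v :+ z) :* G :+ (w :- z) :* H)
        := u :* F :+ v :* G :+ w :* H :+ z :* K) refl u v w z F G H K)

      bezout-FGK : (u + w) * F + (v + w) * G + (z - w) * K ≈ 1#
      bezout-FGK = bezout-with {x = - w} (solve 8 (λ u v w z F G H K →
        :- w :* (F :+ G :- H :- K) :+ ((u :+ w) :* F :+ (v :+ w) :* G :+ (z :- w) :* K)
        := u :* F :+ v :* G :+ w :* H :+ z :* K) refl u v w z F G H K)

      bezout-FHK : (u - v) * F + (w + v) * H + (z + v) * K ≈ 1#
      bezout-FHK = bezout-with {x = v} (solve 8 (λ u v w z F G H K →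
        v :* (F :+ G :- H :- K) :+ ((u :- v) :* F :+ (w :+ v) :* H :+ (z :+ v) :* K)
        := u :* F :+ v :* G :+ w :* H :+ z :* K) refl u v w z F G H K)

      bezout-GHK : (v - u) * G + (w + u) * H + (z + u) * K ≈ 1#
      bezout-GHK = bezout-with {x = u} (solve 8 (λ u v w z F G H K →
        u :* (F :+ G :- H :- K) :+ ((v :- u) :* G :+ (w :+ u) :* H :+ (z :+ u) :* K)
        := u :* F :+ v :* G :+ w :* H :+ z :* K) refl u v w z F G H K)

      -- The exponent there is 4 + k, which equals n = 16 + j at k = 12 + j.
      open ThreeTerms (12 ℕ.+ j) using (three-terms)

      -1≉0 : ¬ (- 1# ≈ 0#)
      -1≉0 = ≉-neg 1≉0

      const-‿1 : Const (- 1#)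
      const-‿1 = const-neg D-1

      module _ (F+G≉0 : ¬ (F + G ≈ 0#))
               (FG≉HK : ¬ (F ≈ H × G ≈ K)) (FG≉KH : ¬ (F ≈ K × G ≈ H)) where

        other : ∀ {x y z t} → x + y ≈ z + t → x ≈ z → y ≈ t
        other {x} {y} {z} {t} h x≈z = begin
          y            ≈⟨ solve 2 (λ x y → y := (x :+ y) :- x) refl x y ⟩
          (x + y) - x  ≈⟨ +-cong h (-‿cong x≈z) ⟩
          (z + t) - z  ≈⟨ solve 2 (λ z t → (z :+ t) :- z := t) refl z t ⟩
          t            ∎

        -- With all three coefficients nonzero, the relation itself has three terms. Otherwise it is
        -- combined with F + G - H - K = 0 so as to leave three powers. The new coefficients that
        -- might vanish are β - α, α + γ and β + γ; in their cases this would force F + G = 0, or F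
        -- = H and G = K, or G = H and F = K. The fourth power is constant by the equation.
        dependent⇒all-const : ∀ α β γ → Const α → Const β → Const γ →
          ¬ (α ≈ 0# × β ≈ 0# × γ ≈ 0#) → α * F + β * G + γ * H ≈ 0# → ¬ ¬ AllConst
        dependent⇒all-const α β γ cα cβ cγ αβγ≉0 relation ¬goal =
          ¬¬-excluded-middle λ α? → ¬¬-excluded-middle λ β? → ¬¬-excluded-middle λ γ? →
          cases α? β? γ?
          where
          cases : Dec (α ≈ 0#) → Dec (β ≈ 0#) → Dec (γ ≈ 0#) → ⊥
          cases (no α≉0) (no β≉0) (no γ≉0) =
            let cF , cG , cH = three-terms cα cβ cγ α≉0 β≉0 γ≉0 relation bezout-FGH
            in ¬goal (cF , cG , cH , const-K cF cG cH)
          cases (no α≉0) (no β≉0) (yes γ≈0) = ¬¬-excluded-middle λ where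
              (yes β-α≈0) → F+G≉0 (zero-product α≉0 (begin
                α * (F + G)
                  ≈⟨ solve 6 (λ α β γ F G H → α :* (F :+ G) :=
                       (α :* F :+ β :* G :+ γ :* H) :- ((β :- α) :* G :+ γ :* H))
                       refl α β γ F G H ⟩
                (α * F + β * G + γ * H) - ((β - α) * G + γ * H)
                  ≈⟨ 0+0 relation (neg0 (0+0 (0*x β-α≈0) (0*x γ≈0))) ⟩
                0# ∎))
              (no β-α≉0) →
                let cG , cH , cK = three-terms
                      (const-+ cβ (const-neg cα)) cα cα β-α≉0 α≉0 α≉0
                      (trans (solve 7 (λ α β γ F G H K →
                        (β :- α) :* G :+ α :* H :+ α :* K :=
                        ((α :* F :+ β :* G :+ γ :* H) :- α :* (F :+ G :- H :- K)) :- γ :* H)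
                        refl α β γ F G H K)
                        (0+0 (0+0 relation (neg0 (x*0 relation₀))) (neg0 (0*x γ≈0))))
                      bezout-GHK
                in ¬goal (const-F cG cH cK , cG , cH , cK)
          -- Here γ may be zero or not: subtracting the relation from α times F + G - H - K removes
          -- F in either case.
          cases (no α≉0) (yes β≈0) _ = ¬¬-excluded-middle λ where
              (yes α+γ≈0) →
                let F≈H = x-y≈0⇒x≈y (zero-product α≉0 (begin
                      α * (F - H)
                        ≈⟨ solve 6 (λ α β γ F G H → α :* (F :- H) :=
                             ((α :* F :+ β :* G :+ γ :* H) :- (α :+ γ) :* H) :- β :* G)
                             refl α β γ F G H ⟩
                      ((α * F + β * G + γ * H) - (α + γ) * H) - β * G
                        ≈⟨ 0+0 (0+0 relation (neg0 (0*x α+γ≈0))) (neg0 (0*x β≈0)) ⟩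
                      0# ∎))
                in FG≉HK (F≈H , other equation F≈H)
              (no α+γ≉0) →
                let cG , cH , cK = three-terms
                      cα (const-neg (const-+ cα cγ)) (const-neg cα)
                      α≉0 (≉-neg α+γ≉0) (≉-neg α≉0)
                      (trans (solve 7 (λ α β γ F G H K →
                        α :* G :+ :- (α :+ γ) :* H :+ :- α :* K :=
                        (α :* (F :+ G :- H :- K) :- (α :* F :+ β :* G :+ γ :* H)) :+ β :* G)
                        refl α β γ F G H K)
                        (0+0 (0+0 (x*0 relation₀) (neg0 relation)) (0*x β≈0)))
                      bezout-GHK
                in ¬goal (const-F cG cH cK , cG , cH , cK)
          cases (yes α≈0) (no β≉0) _ = ¬¬-excluded-middle λ where
              (yes β+γ≈0) →
                let G≈H = x-y≈0⇒x≈y (zero-product β≉0 (begin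
                      β * (G - H)
                        ≈⟨ solve 6 (λ α β γ F G H → β :* (G :- H) :=
                             ((α :* F :+ β :* G :+ γ :* H) :- (β :+ γ) :* H) :- α :* F)
                             refl α β γ F G H ⟩
                      ((α * F + β * G + γ * H) - (β + γ) * H) - α * F
                        ≈⟨ 0+0 (0+0 relation (neg0 (0*x β+γ≈0))) (neg0 (0*x α≈0)) ⟩
                      0# ∎))
                in FG≉KH (other (trans (+-comm G F) equation) G≈H , G≈H)
              (no β+γ≉0) →
                let cF , cH , cK = three-terms
                      cβ (const-neg (const-+ cβ cγ)) (const-neg cβ)
                      β≉0 (≉-neg β+γ≉0) (≉-neg β≉0)
                      (trans (solve 7 (λ α β γ F G H K →
                        β :* F :+ :- (β :+ γ) :* H :+ :- β :* K :=
                        (β :* (F :+ G :- H :- K) :- (α :* F :+ β :* G :+ γ :* H)) :+ α :* F)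
                        refl α β γ F G H K)
                        (0+0 (0+0 (x*0 relation₀) (neg0 relation)) (0*x α≈0)))
                      bezout-FHK
                in ¬goal (cF , const-G cF cH cK , cH , cK)
          -- Only γ H = 0 remains, so H = 0 and the original equation already has three terms.
          cases (yes α≈0) (yes β≈0) (no γ≉0) =
            let H≈0 = zero-product γ≉0 (begin
                  γ * H
                    ≈⟨ solve 6 (λ α β γ F G H → γ :* H :=
                         (α :* F :+ β :* G :+ γ :* H) :- (α :* F :+ β :* G)) refl α β γ F G H ⟩
                  (α * F + β * G + γ * H) - (α * F + β * G)
                    ≈⟨ 0+0 relation (neg0 (0+0 (0*x α≈0) (0*x β≈0))) ⟩
                  0# ∎)
                cF , cG , cK = three-terms D-1 D-1 const-‿1 1≉0 1≉0 -1≉0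
                  (trans (solve 4 (λ F G H K →
                    con (+ 1) :* F :+ con (+ 1) :* G :+ :- con (+ 1) :* K :=
                    (F :+ G :- H :- K) :+ H) refl F G H K)
                    (0+0 relation₀ H≈0))
                  bezout-FGK
            in ¬goal (cF , cG , const-H cF cG cK , cK)
          cases (yes α≈0) (yes β≈0) (yes γ≈0) = αβγ≉0 (α≈0 , β≈0 , γ≈0)

        all-const : ¬ ¬ AllConst
        all-const ¬goal = ¬¬-excluded-middle {A = W ≈ 0#} λ where
          (yes W≈0) → wronskian₃≈0⇒dependent F G H W≈0
            λ (α , β , γ , cα , cβ , cγ , αβγ≉0 , relation) →
              dependent⇒all-const α β γ cα cβ cγ αβγ≉0 relation ¬goal
          (no W≉0) → W≉0⇒all-const W≉0 ¬goal

  -- Bézout relations, powers and common divisors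

  Unimodular : (x₁ x₂ x₃ x₄ : Carrier) → Set (c ⊔ ℓ)
  Unimodular x₁ x₂ x₃ x₄ = Σ[ u ∈ Carrier ] Σ[ v ∈ Carrier ] Σ[ w ∈ Carrier ] Σ[ z ∈ Carrier ]
    u * x₁ + v * x₂ + w * x₃ + z * x₄ ≈ 1#

  -- Multiplying the term with a to the n by 1 = u a + y gains one factor a, and the rest is a
  -- multiple of y. In the application y is the sum of the other three Bézout terms, which all take
  -- on the factor z.
  comaximal-^ : ∀ {u a y} → u * a + y ≈ 1# → ∀ n → ∃₂ λ u′ z → u′ * a ^ n + y * z ≈ 1#
  comaximal-^ {y = y} h zero = 1# , 0# ,
    solve 1 (λ y → con (+ 1) :* con (+ 1) :+ y :* con (+ 0) := con (+ 1)) refl y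
  comaximal-^ {u} {a} {y} h (suc n) =
    let u′ , z , h′ = comaximal-^ h n in u′ * u , u′ * a ^ n + z , (begin
      u′ * u * (a * a ^ n) + y * (u′ * a ^ n + z)
        ≈⟨ solve 6 (λ u u′ a aⁿ y z → u′ :* u :* (a :* aⁿ) :+ y :* (u′ :* aⁿ :+ z)
             := u′ :* aⁿ :* (u :* a :+ y) :+ y :* z) refl u u′ a (a ^ n) y z ⟩
      u′ * a ^ n * (u * a + y) + y * z
        ≈⟨ +-congʳ (trans (*-congˡ h) (*-identityʳ _)) ⟩
      u′ * a ^ n + y * z
        ≈⟨ h′ ⟩
      1# ∎)

  -- The treated entry moves to the end, so four applications raise every entry once and restore the
  -- order.
  unimodular-rotate-^ : ∀ n {a b c d} → Unimodular a b c d → Unimodular b c d (a ^ n)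
  unimodular-rotate-^ n {a} {b} {c} {d} (u , v , w , z , h) =
    let u′ , y , h′ = comaximal-^ (trans
          (solve 8 (λ u v w z a b c d → u :* a :+ (v :* b :+ w :* c :+ z :* d)
            := u :* a :+ v :* b :+ w :* c :+ z :* d) refl u v w z a b c d) h) n
    in v * y , w * y , z * y , u′ , trans
      (solve 9 (λ u v w z y aⁿ b c d →
        v :* y :* b :+ w :* y :* c :+ z :* y :* d :+ u :* aⁿ
        := u :* aⁿ :+ (v :* b :+ w :* c :+ z :* d) :* y) refl u′ v w z y (a ^ n) b c d) h′

  unimodular-^ : ∀ n {a b c d} → Unimodular a b c d →
    Unimodular (a ^ n) (b ^ n) (c ^ n) (d ^ n)
  unimodular-^ n h = unimodular-rotate-^ n (unimodular-rotate-^ n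
    (unimodular-rotate-^ n (unimodular-rotate-^ n h)))

  gcd₄ : ∀ p q r s → ¬ ¬ (Σ[ t ∈ Carrier ] Σ[ a ∈ Carrier ] Σ[ b ∈ Carrier ]
    Σ[ c ∈ Carrier ] Σ[ d ∈ Carrier ]
    (p ≈ t * a) × (q ≈ t * b) × (r ≈ t * c) × (s ≈ t * d) × Unimodular a b c d)
  gcd₄ p q r s ¬goal =
    gcd p q λ (t₁ , a , b , u , v , p≈ , q≈ , uv) →
    gcd r s λ (t₂ , c , d , w , z , r≈ , s≈ , wz) →
    gcd t₁ t₂ λ (t , e , f , x , y , t₁≈ , t₂≈ , xy) →
    ¬goal (t , e * a , e * b , f * c , f * d
      , through p≈ t₁≈ , through q≈ t₁≈ , through r≈ t₂≈ , through s≈ t₂≈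
      , x * u , x * v , y * w , y * z , (begin
        x * u * (e * a) + x * v * (e * b) + y * w * (f * c) + y * z * (f * d)
          ≈⟨ solve 12 (λ x y u v w z a b c d e f →
               x :* u :* (e :* a) :+ x :* v :* (e :* b) :+ y :* w :* (f :* c) :+ y :* z :* (f :* d)
               := x :* e :* (u :* a :+ v :* b) :+ y :* f :* (w :* c :+ z :* d))
               refl x y u v w z a b c d e f ⟩
        x * e * (u * a + v * b) + y * f * (w * c + z * d)
          ≈⟨ +-cong (trans (*-congˡ uv) (*-identityʳ _)) (trans (*-congˡ wz) (*-identityʳ _)) ⟩
        x * e + y * f
          ≈⟨ xy ⟩
        1# ∎))
    where
    through : ∀ {p t₁ a t e} → p ≈ t₁ * a → t₁ ≈ t * e → p ≈ t * (e * a)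
    through h k = trans h (trans (*-congʳ k) (*-assoc _ _ _))

  unimodular-scale : ∀ {t t′ a b c d p q r s} → t * t′ ≈ 1# →
    p ≈ t * a → q ≈ t * b → r ≈ t * c → s ≈ t * d → Unimodular a b c d → Unimodular p q r s
  unimodular-scale {t} {t′} {a} {b} {c} {d} {p} {q} {r} {s} tt′ p≈ q≈ r≈ s≈ (u , v , w , z , h) =
    t′ * u , t′ * v , t′ * w , t′ * z , (begin
      t′ * u * p + t′ * v * q + t′ * w * r + t′ * z * s
        ≈⟨ +-cong (+-cong (+-cong (*-congˡ p≈) (*-congˡ q≈)) (*-congˡ r≈)) (*-congˡ s≈) ⟩
      t′ * u * (t * a) + t′ * v * (t * b) + t′ * w * (t * c) + t′ * z * (t * d)
        ≈⟨ solve 10 (λ t t′ u v w z a b c d →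
             t′ :* u :* (t :* a) :+ t′ :* v :* (t :* b) :+ t′ :* w :* (t :* c) :+ t′ :* z :* (t :* d)
             := t :* t′ :* (u :* a :+ v :* b :+ w :* c :+ z :* d)) refl t t′ u v w z a b c d ⟩
      t * t′ * (u * a + v * b + w * c + z * d)
        ≈⟨ *-cong tt′ h ⟩
      1# * 1#
        ≈⟨ *-identityˡ 1# ⟩
      1# ∎)

  -- If p is nonzero of degree d, the power has degree (n + 1) d, which is at least d; being
  -- constant, it forces d = 0.
  const-^⇒const : ∀ n {p} → Const (p ^ suc n) → Const p
  const-^⇒const n {p} h = by-cases {A = p ≈ 0#}
    (λ p≈0 → trans (D-cong p≈0) D-0)
    (λ p≉0 → stable λ ¬c → Deg-exists p≉0 λ (d , hp) →
      ¬c (Deg≤0⇒D≈0 (≡.subst (Deg≤ p)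
        (ℕ.n≤0⇒n≡0 (ℕ.m+n≤o⇒m≤o d (Deg-least (Deg-^ hp (suc n)) (D≈0⇒Deg≤0 h))))
        (Deg⇒Deg≤ hp))))

  -- The gcd t is itself a common divisor, hence constant, and it is nonzero because p and q do not
  -- both vanish. So t is a unit, and the Bézout relation of the quotients rescales to p, q, r, s.
  common-divisor-const⇒unimodular : ∀ {p q r s} → ¬ (p ≈ 0# × q ≈ 0#) →
    (∀ t a b c d → p ≈ t * a → q ≈ t * b → r ≈ t * c → s ≈ t * d → Const t) →
    ¬ ¬ Unimodular p q r s
  common-divisor-const⇒unimodular {p} {q} {r} {s} pq≉0 coprime ¬goal =
    gcd₄ p q r s λ (t , a , b , c , d , p≈ , q≈ , r≈ , s≈ , um) →
    Deg-exists (λ t≈0 → pq≉0 (trans p≈ (0*x t≈0) , trans q≈ (0*x t≈0))) λ (e , ht) →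
    Deg0-unit (≡.subst (Deg t)
        (ℕ.n≤0⇒n≡0 (Deg-least ht (D≈0⇒Deg≤0 (coprime t a b c d p≈ q≈ r≈ s≈)))) ht)
      λ (t′ , tt′) →
    ¬goal (unimodular-scale tt′ p≈ q≈ r≈ s≈ um)

  equal-sums⇒const-^ : ∀ j {p q r s} → let n = 16 ℕ.+ j in
    p ^ n + q ^ n ≈ r ^ n + s ^ n → ¬ (p ^ n + q ^ n ≈ 0#) →
    ¬ (p ^ n ≈ r ^ n × q ^ n ≈ s ^ n) → ¬ (p ^ n ≈ s ^ n × q ^ n ≈ r ^ n) →
    Unimodular p q r s →
    ¬ ¬ (Const (p ^ n) × Const (q ^ n) × Const (r ^ n) × Const (s ^ n))
  equal-sums⇒const-^ j {p} {q} {r} {s} equation sum≉0 pq≉rs pq≉sr um =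
    let u , v , w , z , bezout = unimodular-^ (16 ℕ.+ j) um in
    EqualSums.all-const j {p} {q} {r} {s}
      record { equation = equation ; u = u ; v = v ; w = w ; z = z ; bezout = bezout }
      sum≉0 pq≉rs pq≉sr

  equal-sums⇒const : ∀ j {p q r s} → let n = 16 ℕ.+ j in
    p ^ n + q ^ n ≈ r ^ n + s ^ n → ¬ (p ^ n + q ^ n ≈ 0#) →
    ¬ (p ^ n ≈ r ^ n × q ^ n ≈ s ^ n) → ¬ (p ^ n ≈ s ^ n × q ^ n ≈ r ^ n) →
    (∀ t a b c d → p ≈ t * a → q ≈ t * b → r ≈ t * c → s ≈ t * d → Const t) →
    Const p × Const q × Const r × Const s
  equal-sums⇒const j {p} {q} {r} {s} equation sum≉0 pq≉rs pq≉sr coprime =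
      const-^⇒const 15+j {p} (stable λ ¬c → conclusion λ (c , _) → ¬c c)
    , const-^⇒const 15+j {q} (stable λ ¬c → conclusion λ (_ , c , _) → ¬c c)
    , const-^⇒const 15+j {r} (stable λ ¬c → conclusion λ (_ , _ , c , _) → ¬c c)
    , const-^⇒const 15+j {s} (stable λ ¬c → conclusion λ (_ , _ , _ , c) → ¬c c)
    where
    15+j = 15 ℕ.+ j
    n = 16 ℕ.+ j
    conclusion : ¬ ¬ (Const (p ^ n) × Const (q ^ n) × Const (r ^ n) × Const (s ^ n))
    conclusion ¬goal = common-divisor-const⇒unimodular {p} {q} {r} {s}
      (λ (p≈0 , q≈0) → sum≉0 (0+0 (x≈0⇒x^suc≈0 {p} p≈0 15+j) (x≈0⇒x^suc≈0 {q} q≈0 15+j)))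
      coprime
      λ um → equal-sums⇒const-^ j {p} {q} {r} {s} equation sum≉0 pq≉rs pq≉sr um ¬goal

-- Polynomials over a field

module Convolution {c ℓ} (R : CommutativeRing c ℓ) where
  open CommutativeRing R
  open IntegerCoefficientSolver R
  open SetoidReasoning setoid

  -- The Cauchy product, with the recursion of list multiplication. Coefficient functions are
  -- insensitive to trailing zeros, so the ring laws are proved for them and carried over by
  -- `coeff-*`.
  conv : (ℕ → Carrier) → (ℕ → Carrier) → ℕ → Carrier
  conv f g zero    = f 0 * g 0
  conv f g (suc k) = f 0 * g (suc k) + conv (f ∘ suc) g k

  conv-cong : ∀ {f f′ g g′} → (∀ k → f k ≈ f′ k) → (∀ k → g k ≈ g′ k) →
    ∀ k → conv f g k ≈ conv f′ g′ k
  conv-cong hf hg zero    = *-cong (hf 0) (hg 0)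
  conv-cong hf hg (suc k) =
    +-cong (*-cong (hf 0) (hg (suc k))) (conv-cong (hf ∘ suc) hg k)

  conv-zeroˡ : ∀ {f} g → (∀ k → f k ≈ 0#) → ∀ k → conv f g k ≈ 0#
  conv-zeroˡ g hf zero    = trans (*-congʳ (hf 0)) (zeroˡ _)
  conv-zeroˡ g hf (suc k) = trans
    (+-cong (trans (*-congʳ (hf 0)) (zeroˡ _)) (conv-zeroˡ g (hf ∘ suc) k)) (+-identityˡ 0#)

  conv-+ˡ : ∀ f g h k → conv (λ i → f i + g i) h k ≈ conv f h k + conv g h k
  conv-+ˡ f g h zero    = distribʳ _ _ _
  conv-+ˡ f g h (suc k) = trans (+-congˡ (conv-+ˡ (f ∘ suc) (g ∘ suc) h k))
    (solve 5 (λ f g h a b → (f :+ g) :* h :+ (a :+ b) := (f :* h :+ a) :+ (g :* h :+ b))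
      refl _ _ _ _ _)

  conv-scaleˡ : ∀ a f g k → conv (λ i → a * f i) g k ≈ a * conv f g k
  conv-scaleˡ a f g zero    = *-assoc _ _ _
  conv-scaleˡ a f g (suc k) = trans (+-congˡ (conv-scaleˡ a (f ∘ suc) g k))
    (solve 4 (λ a f g c → a :* f :* g :+ a :* c := a :* (f :* g :+ c)) refl _ _ _ _)

  -- The definition splits off the first summand; commutativity also needs the last one split off.
  conv-suc : ∀ f g k → conv f g (suc k) ≈ conv f (g ∘ suc) k + f (suc k) * g 0
  conv-suc f g zero    = refl
  conv-suc f g (suc k) = trans (+-congˡ (conv-suc (f ∘ suc) g k)) (sym (+-assoc _ _ _))

  conv-comm : ∀ f g k → conv f g k ≈ conv g f k
  conv-comm f g zero    = *-comm _ _
  conv-comm f g (suc k) = begin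
    f 0 * g (suc k) + conv (f ∘ suc) g k  ≈⟨ +-cong (*-comm _ _) (conv-comm (f ∘ suc) g k) ⟩
    g (suc k) * f 0 + conv g (f ∘ suc) k  ≈⟨ +-comm _ _ ⟩
    conv g (f ∘ suc) k + g (suc k) * f 0  ≈⟨ conv-suc g f k ⟨
    conv g f (suc k)                      ∎

  conv-assoc : ∀ f g h k → conv (conv f g) h k ≈ conv f (conv g h) k
  conv-assoc f g h zero    = *-assoc _ _ _
  conv-assoc f g h (suc k) = begin
    f 0 * g 0 * h (suc k) + conv (λ i → f 0 * g (suc i) + conv (f ∘ suc) g i) h k
      ≈⟨ +-congˡ (conv-+ˡ (λ i → f 0 * g (suc i)) (conv (f ∘ suc) g) h k) ⟩
    f 0 * g 0 * h (suc k) + (conv (λ i → f 0 * g (suc i)) h k + conv (conv (f ∘ suc) g) h k)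
      ≈⟨ +-congˡ (+-cong (conv-scaleˡ (f 0) (g ∘ suc) h k) (conv-assoc (f ∘ suc) g h k)) ⟩
    f 0 * g 0 * h (suc k) + (f 0 * conv (g ∘ suc) h k + conv (f ∘ suc) (conv g h) k)
      ≈⟨ solve 5 (λ f g h a b → f :* g :* h :+ (f :* a :+ b) := f :* (g :* h :+ a) :+ b)
           refl (f 0) (g 0) (h (suc k)) _ _ ⟩
    f 0 * (g 0 * h (suc k) + conv (g ∘ suc) h k) + conv (f ∘ suc) (conv g h) k ∎

  conv-bounded : ∀ {f g} d e → (∀ k → d ℕ.< k → f k ≈ 0#) → (∀ k → e ℕ.< k → g k ≈ 0#) →
    ∀ k → d ℕ.+ e ℕ.< k → conv f g k ≈ 0#
  conv-bounded {f} {g} d e hf hg (suc k) (s≤s d+e≤k) = begin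
    f 0 * g (suc k) + conv (f ∘ suc) g k
      ≈⟨ +-cong (trans (*-congˡ (hg (suc k) (s≤s (ℕ.m+n≤o⇒n≤o d d+e≤k)))) (zeroʳ _))
                (tail d hf d+e≤k) ⟩
    0# + 0#  ≈⟨ +-identityˡ 0# ⟩
    0#       ∎
    where
    tail : ∀ d → (∀ k → d ℕ.< k → f k ≈ 0#) → d ℕ.+ e ℕ.≤ k → conv (f ∘ suc) g k ≈ 0#
    tail zero    hf _    = conv-zeroˡ g (λ i → hf (suc i) (s≤s z≤n)) k
    tail (suc d) hf d+e< = conv-bounded d e (λ i d<i → hf (suc i) (s≤s d<i)) hg k d+e<

  conv-leading : ∀ {f g} d e → (∀ k → d ℕ.< k → f k ≈ 0#) → (∀ k → e ℕ.< k → g k ≈ 0#) →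
    conv f g (d ℕ.+ e) ≈ f d * g e
  conv-leading zero zero hf hg = refl
  conv-leading {f} {g} zero (suc e) hf hg =
    trans (+-congˡ (conv-zeroˡ g (λ i → hf (suc i) (s≤s z≤n)) e)) (+-identityʳ _)
  conv-leading {f} {g} (suc d) e hf hg = begin
    f 0 * g (suc (d ℕ.+ e)) + conv (f ∘ suc) g (d ℕ.+ e)
      ≈⟨ +-cong (trans (*-congˡ (hg _ (s≤s (ℕ.m≤n+m e d)))) (zeroʳ _))
                (conv-leading d e (λ i d<i → hf (suc i) (s≤s d<i)) hg) ⟩
    0# + f (suc d) * g e  ≈⟨ +-identityˡ _ ⟩
    f (suc d) * g e       ∎

module Gcd {c ℓ} (R : CommutativeRing c ℓ) where
  open CommutativeRing R
  open IntegerCoefficientSolver R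
  open SetoidReasoning setoid

  -- Bézout is stated for the quotients rather than as u x + v y = t, so it keeps its content when t
  -- = 0 and never requires cancelling t.
  GcdOf : Carrier → Carrier → Set (c ⊔ ℓ)
  GcdOf x y = Σ[ t ∈ Carrier ] Σ[ a ∈ Carrier ] Σ[ b ∈ Carrier ]
    Σ[ u ∈ Carrier ] Σ[ v ∈ Carrier ]
    (x ≈ t * a) × (y ≈ t * b) × (u * a + v * b ≈ 1#)

  gcd-swap : ∀ x y → GcdOf x y → GcdOf y x
  gcd-swap x y (t , a , b , u , v , hx , hy , h) =
    t , b , a , v , u , hy , hx , trans (+-comm _ _) h

  gcd-0ˡ : ∀ x y → x ≈ 0# → GcdOf x y
  gcd-0ˡ x y x≈0 = y , 0# , 1# , 0# , 1# ,
    trans x≈0 (sym (zeroʳ y)) , sym (*-identityʳ y) ,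
    solve 0 (con (+ 0) :* con (+ 0) :+ con (+ 1) :* con (+ 1) := con (+ 1)) refl

  gcd-subtract : ∀ x y m → GcdOf x (y - m * x) → GcdOf x y
  gcd-subtract x y m (t , a , b , u , v , hx , hy , h) =
    t , a , b + m * a , u - v * m , v , hx ,
    (begin
      y                    ≈⟨ solve 3 (λ x y m → y := (y :- m :* x) :+ m :* x) refl x y m ⟩
      (y - m * x) + m * x  ≈⟨ +-cong hy (*-congˡ hx) ⟩
      t * b + m * (t * a)
        ≈⟨ solve 4 (λ t a b m → t :* b :+ m :* (t :* a) := t :* (b :+ m :* a)) refl t a b m ⟩
      t * (b + m * a)      ∎) ,
    trans (solve 5 (λ a b u v m → (u :- v :* m) :* a :+ v :* (b :+ m :* a)
            := u :* a :+ v :* b) refl a b u v m) h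

-- Inverses exist only under ¬ ¬: the reciprocal of a Cauchy sequence needs a positive lower bound
-- on its absolute values, and x ≠ 0 does not provide one explicitly.
record ClassicalField c ℓ : Set (lsuc (c ⊔ ℓ)) where
  field
    commutativeRing : CommutativeRing c ℓ
  open CommutativeRing commutativeRing public
  open MonoidMult +-monoid using () renaming (_×_ to _·_)
  field
    stable         : ∀ {x y} → ¬ ¬ (x ≈ y) → x ≈ y
    inverse        : ∀ {x} → ¬ (x ≈ 0#) → ¬ ¬ ∃ λ y → x * y ≈ 1#
    characteristic : ∀ n → ¬ (suc n · 1# ≈ 0#)

-- The polynomial ring, its derivation and the Euclidean algorithm

module PolynomialRing {c ℓ} (K : ClassicalField c ℓ) where
  open ClassicalField K
  open MonoidMult +-monoid renaming (_×_ to _·_) using (×-congʳ)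
  open CommutativeMonoidMult +-commutativeMonoid using (×-distrib-+)
  open SemiringMult semiring using (×-comm-*; ×-assoc-*)
  open GroupProperties +-group using (ε⁻¹≈ε)
  open IntegerCoefficientSolver commutativeRing
  open SetoidReasoning setoid
  open Zeros commutativeRing
  open Convolution commutativeRing
  private module P = Polynomials rawRing
  open P using (Poly; coeff)

  ·-0 : ∀ n {x} → x ≈ 0# → n · x ≈ 0#
  ·-0 zero    h = refl
  ·-0 (suc n) h = 0+0 h (·-0 n h)

  zero-product : ∀ {x y} → ¬ (x ≈ 0#) → x * y ≈ 0# → y ≈ 0#
  zero-product {x} {y} x≉0 xy≈0 = stable λ y≉0 → inverse x≉0 λ (w , xw≈1) → y≉0 (begin
    y            ≈⟨ *-identityˡ y ⟨
    1# * y       ≈⟨ *-congʳ xw≈1 ⟨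
    x * w * y    ≈⟨ solve 3 (λ x w y → x :* w :* y := w :* (x :* y)) refl x w y ⟩
    w * (x * y)  ≈⟨ trans (*-congˡ xy≈0) (zeroʳ w) ⟩
    0#           ∎)

  ·-zero-product : ∀ n {x} → suc n · x ≈ 0# → x ≈ 0#
  ·-zero-product n {x} h = zero-product (characteristic n)
    (trans (×-assoc-* (suc n) 1# x) (trans (×-congʳ (suc n) (*-identityˡ x)) h))

  1≉0 : ¬ (1# ≈ 0#)
  1≉0 h = characteristic 0 (0+0 h refl)

  coeff-+ : ∀ p q k → coeff (p P.+ q) k ≈ coeff p k + coeff q k
  coeff-+ []      q       k       = sym (+-identityˡ _)
  coeff-+ (a ∷ p) []      k       = sym (+-identityʳ _)
  coeff-+ (a ∷ p) (b ∷ q) zero    = refl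
  coeff-+ (a ∷ p) (b ∷ q) (suc k) = coeff-+ p q k

  coeff-neg : ∀ p k → coeff (P.neg p) k ≈ - coeff p k
  coeff-neg []      k       = sym ε⁻¹≈ε
  coeff-neg (a ∷ p) zero    = refl
  coeff-neg (a ∷ p) (suc k) = coeff-neg p k

  coeff-map : ∀ a p k → coeff (map (a *_) p) k ≈ a * coeff p k
  coeff-map a []      k       = sym (zeroʳ a)
  coeff-map a (b ∷ p) zero    = refl
  coeff-map a (b ∷ p) (suc k) = coeff-map a p k

  coeff-* : ∀ p q k → coeff (p P.* q) k ≈ conv (coeff p) (coeff q) k
  coeff-* []      q k       = sym (conv-zeroˡ (coeff q) (λ _ → refl) k)
  coeff-* (a ∷ p) q zero    = trans (coeff-+ (map (a *_) q) (0# ∷ p P.* q) 0)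
    (trans (+-identityʳ _) (coeff-map a q 0))
  coeff-* (a ∷ p) q (suc k) = trans (coeff-+ (map (a *_) q) (0# ∷ p P.* q) (suc k))
    (+-cong (coeff-map a q (suc k)) (coeff-* p q k))

  polynomialRing : CommutativeRing c ℓ
  polynomialRing = record
    { Carrier = Poly ; _≈_ = P._≈_ ; _+_ = P._+_ ; _*_ = P._*_ ; -_ = P.neg
    ; 0# = P.0# ; 1# = P.1#
    ; isCommutativeRing = record
      { isRing = record
        { +-isAbelianGroup = record
          { isGroup = record
            { isMonoid = record
              { isSemigroup = record
                { isMagma = record
                  { isEquivalence = record
                    { refl  = λ k → refl
                    ; sym   = λ h k → sym (h k)
                    ; trans = λ h h′ k → trans (h k) (h′ k)
                    }
                  ; ∙-cong = λ {p} {p′} {q} {q′} hp hq k → trans (coeff-+ p q k)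
                      (trans (+-cong (hp k) (hq k)) (sym (coeff-+ p′ q′ k)))
                  }
                ; assoc = λ p q r k → trans
                    (trans (coeff-+ (p P.+ q) r k) (+-congʳ (coeff-+ p q k)))
                    (trans (+-assoc _ _ _)
                    (sym (trans (coeff-+ p (q P.+ r) k) (+-congˡ (coeff-+ q r k)))))
                }
              ; identity = (λ p k → refl) ,
                  λ p k → trans (coeff-+ p [] k) (+-identityʳ _)
              }
            ; inverse =
                (λ p k → trans (coeff-+ (P.neg p) p k)
                  (trans (+-congʳ (coeff-neg p k)) (-‿inverseˡ _))) ,
                λ p k → trans (coeff-+ p (P.neg p) k)
                  (trans (+-congˡ (coeff-neg p k)) (-‿inverseʳ _))
            ; ⁻¹-cong = λ {p} {q} h k →
                trans (coeff-neg p k) (trans (-‿cong (h k)) (sym (coeff-neg q k)))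
            }
          ; comm = λ p q k → trans (coeff-+ p q k)
              (trans (+-comm _ _) (sym (coeff-+ q p k)))
          }
        ; *-cong = λ {p} {p′} {q} {q′} hp hq k → trans (coeff-* p q k)
            (trans (conv-cong hp hq k) (sym (coeff-* p′ q′ k)))
        ; *-assoc = λ p q r k → begin
            coeff ((p P.* q) P.* r) k
              ≈⟨ coeff-* (p P.* q) r k ⟩
            conv (coeff (p P.* q)) (coeff r) k
              ≈⟨ conv-cong (coeff-* p q) (λ _ → refl) k ⟩
            conv (conv (coeff p) (coeff q)) (coeff r) k
              ≈⟨ conv-assoc (coeff p) (coeff q) (coeff r) k ⟩
            conv (coeff p) (conv (coeff q) (coeff r)) k
              ≈⟨ conv-cong (λ _ → refl) (coeff-* q r) k ⟨
            conv (coeff p) (coeff (q P.* r)) k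
              ≈⟨ coeff-* p (q P.* r) k ⟨
            coeff (p P.* (q P.* r)) k ∎
        ; *-identity = *-identityˡᴾ , λ p k → trans (*-commᴾ p P.1# k) (*-identityˡᴾ p k)
        ; distrib = (λ p q r k → begin
            coeff (p P.* (q P.+ r)) k  ≈⟨ *-commᴾ p (q P.+ r) k ⟩
            coeff ((q P.+ r) P.* p) k  ≈⟨ *-distribʳᴾ p q r k ⟩
            coeff (q P.* p P.+ r P.* p) k
              ≈⟨ trans (coeff-+ (q P.* p) (r P.* p) k)
                   (+-cong (*-commᴾ q p k) (*-commᴾ r p k)) ⟩
            coeff (p P.* q) k + coeff (p P.* r) k
              ≈⟨ coeff-+ (p P.* q) (p P.* r) k ⟨
            coeff (p P.* q P.+ p P.* r) k ∎) , *-distribʳᴾ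
        }
      ; *-comm = *-commᴾ
      }
    }
    where
    *-commᴾ : ∀ p q → p P.* q P.≈ q P.* p
    *-commᴾ p q k = trans (coeff-* p q k)
      (trans (conv-comm (coeff p) (coeff q) k) (sym (coeff-* q p k)))
    *-identityˡᴾ : ∀ p → P.1# P.* p P.≈ p
    *-identityˡᴾ p zero = trans (coeff-* P.1# p 0) (*-identityˡ _)
    *-identityˡᴾ p (suc k) = trans (coeff-* P.1# p (suc k)) (trans
      (+-cong (*-identityˡ _) (conv-zeroˡ (coeff p) (λ _ → refl) k)) (+-identityʳ _))
    *-distribʳᴾ : ∀ p q r → (q P.+ r) P.* p P.≈ q P.* p P.+ r P.* p
    *-distribʳᴾ p q r k = begin
      coeff ((q P.+ r) P.* p) k
        ≈⟨ coeff-* (q P.+ r) p k ⟩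
      conv (coeff (q P.+ r)) (coeff p) k
        ≈⟨ conv-cong (coeff-+ q r) (λ _ → refl) k ⟩
      conv (λ i → coeff q i + coeff r i) (coeff p) k
        ≈⟨ conv-+ˡ (coeff q) (coeff r) (coeff p) k ⟩
      conv (coeff q) (coeff p) k + conv (coeff r) (coeff p) k
        ≈⟨ +-cong (coeff-* q p k) (coeff-* r p k) ⟨
      coeff (q P.* p) k + coeff (r P.* p) k
        ≈⟨ coeff-+ (q P.* p) (r P.* p) k ⟨
      coeff (q P.* p P.+ r P.* p) k ∎

  -- A list `a ∷ p` is the polynomial a + x p, whose derivative is p + x p′.
  D : Poly → Poly
  D []      = []
  D (a ∷ p) = p P.+ (0# ∷ D p)

  coeff-D : ∀ p k → coeff (D p) k ≈ suc k · coeff p (suc k)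
  coeff-D []      k       = sym (·-0 (suc k) refl)
  coeff-D (a ∷ p) zero    = coeff-+ p (0# ∷ D p) 0
  coeff-D (a ∷ p) (suc k) = trans (coeff-+ p (0# ∷ D p) (suc k)) (+-congˡ (coeff-D p k))

  D-cong : ∀ p q → p P.≈ q → D p P.≈ D q
  D-cong p q h k = trans (coeff-D p k) (trans (×-congʳ (suc k) (h (suc k))) (sym (coeff-D q k)))

  D-+ : ∀ p q → D (p P.+ q) P.≈ D p P.+ D q
  D-+ p q k = begin
    coeff (D (p P.+ q)) k                             ≈⟨ coeff-D (p P.+ q) k ⟩
    suc k · coeff (p P.+ q) (suc k)                   ≈⟨ ×-congʳ (suc k) (coeff-+ p q (suc k)) ⟩
    suc k · (coeff p (suc k) + coeff q (suc k))       ≈⟨ ×-distrib-+ _ _ (suc k) ⟩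
    suc k · coeff p (suc k) + suc k · coeff q (suc k) ≈⟨ +-cong (coeff-D p k) (coeff-D q k) ⟨
    coeff (D p) k + coeff (D q) k                     ≈⟨ coeff-+ (D p) (D q) k ⟨
    coeff (D p P.+ D q) k                             ∎

  D-map : ∀ a p → D (map (a *_) p) P.≈ map (a *_) (D p)
  D-map a p k = begin
    coeff (D (map (a *_) p)) k         ≈⟨ coeff-D (map (a *_) p) k ⟩
    suc k · coeff (map (a *_) p) (suc k) ≈⟨ ×-congʳ (suc k) (coeff-map a p (suc k)) ⟩
    suc k · (a * coeff p (suc k))      ≈⟨ ×-comm-* (suc k) a _ ⟨
    a * (suc k · coeff p (suc k))      ≈⟨ *-congˡ (coeff-D p k) ⟨
    a * coeff (D p) k                  ≈⟨ coeff-map a (D p) k ⟨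
    coeff (map (a *_) (D p)) k         ∎

  D-* : ∀ p q → D (p P.* q) P.≈ D p P.* q P.+ p P.* D q
  D-* [] q k = refl
  D-* (a ∷ p) q k = begin
    coeff (D (map (a *_) q P.+ (0# ∷ p P.* q))) k
      ≈⟨ D-+ (map (a *_) q) (0# ∷ p P.* q) k ⟩
    coeff (D (map (a *_) q) P.+ D (0# ∷ p P.* q)) k
      ≈⟨ coeff-+ (D (map (a *_) q)) (D (0# ∷ p P.* q)) k ⟩
    coeff (D (map (a *_) q)) k + coeff (p P.* q P.+ (0# ∷ D (p P.* q))) k
      ≈⟨ +-cong (D-map a q k) (coeff-+ (p P.* q) (0# ∷ D (p P.* q)) k) ⟩
    coeff (map (a *_) (D q)) k + (coeff (p P.* q) k + coeff (0# ∷ D (p P.* q)) k)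
      ≈⟨ +-congˡ (+-congˡ (shifted k)) ⟩
    coeff (map (a *_) (D q)) k + (coeff (p P.* q) k
      + (coeff (0# ∷ D p P.* q) k + coeff (0# ∷ p P.* D q) k))
      -- The inserted zero stands for `map (0# *_) q`, which appears when `(0# ∷ D p) P.* q`
      -- unfolds.
      ≈⟨ solve 4 (λ a b c d → a :+ (b :+ (c :+ d)) := (b :+ (con (+ 0) :+ c)) :+ (a :+ d)) refl _ _ _ _ ⟩
    (coeff (p P.* q) k + (0# + coeff (0# ∷ D p P.* q) k))
      + (coeff (map (a *_) (D q)) k + coeff (0# ∷ p P.* D q) k)
      ≈⟨ +-cong (+-congˡ (+-congʳ (trans (coeff-map 0# q k) (zeroˡ _))))
                (coeff-+ (map (a *_) (D q)) (0# ∷ p P.* D q) k) ⟨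
    (coeff (p P.* q) k + (coeff (map (0# *_) q) k + coeff (0# ∷ D p P.* q) k))
      + coeff ((a ∷ p) P.* D q) k
      ≈⟨ +-congʳ (+-congˡ (coeff-+ (map (0# *_) q) (0# ∷ D p P.* q) k)) ⟨
    (coeff (p P.* q) k + coeff ((0# ∷ D p) P.* q) k) + coeff ((a ∷ p) P.* D q) k
      ≈⟨ +-congʳ (trans (ring.distribʳ q p (0# ∷ D p) k)
           (coeff-+ (p P.* q) ((0# ∷ D p) P.* q) k)) ⟨
    coeff (D (a ∷ p) P.* q) k + coeff ((a ∷ p) P.* D q) k
      ≈⟨ coeff-+ (D (a ∷ p) P.* q) ((a ∷ p) P.* D q) k ⟨
    coeff (D (a ∷ p) P.* q P.+ (a ∷ p) P.* D q) k ∎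
    where
    module ring = CommutativeRing polynomialRing
    shifted : ∀ k → coeff (0# ∷ D (p P.* q)) k
      ≈ coeff (0# ∷ D p P.* q) k + coeff (0# ∷ p P.* D q) k
    shifted zero    = sym (+-identityˡ 0#)
    shifted (suc k) = trans (D-* p q k) (coeff-+ (D p P.* q) (p P.* D q) k)

  -- Shifted by one against `DegreeAtMost`: the bound `suc n` unfolds to degree at most n, and the
  -- bound 0 covers the zero polynomial.
  Bounded : Poly → ℕ → Set ℓ
  Bounded p n = ∀ k → n ℕ.≤ k → coeff p k ≈ 0#

  bounded-length : ∀ p → Bounded p (length p)
  bounded-length []      k       _         = refl
  bounded-length (a ∷ p) (suc k) (s≤s n≤k) = bounded-length p k n≤k

  bounded-pred : ∀ p n → Bounded p (suc n) → coeff p n ≈ 0# → Bounded p n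
  bounded-pred p n h h₀ k n≤k with ℕ.m≤n⇒m<n∨m≡n n≤k
  ... | inj₁ n<k    = h k n<k
  ... | inj₂ ≡.refl = h₀

  -- The list length is a first bound; it is lowered past each vanishing top coefficient, every test
  -- being made under ¬ ¬.
  degree-exists : ∀ p → ¬ (p P.≈ P.0#) → ¬ ¬ ∃ (P.HasDegree p)
  degree-exists p p≉0 ¬goal = go (length p) (bounded-length p)
    where
    go : ∀ n → Bounded p n → ⊥
    go zero    h = p≉0 (λ k → h k z≤n)
    go (suc n) h = ¬¬-excluded-middle λ where
      (yes h₀) → go n (bounded-pred p n h h₀)
      (no h₀)  → ¬goal (n , h₀ , h)

  polynomial-stable : ∀ p q → ¬ ¬ (p P.≈ q) → p P.≈ q
  polynomial-stable p q h k = stable λ ¬eq → h λ eq → ¬eq (eq k)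

  degree-* : ∀ p q d e → P.HasDegree p d → P.HasDegree q e → P.HasDegree (p P.* q) (d ℕ.+ e)
  degree-* p q d e (p≉0 , hp) (q≉0 , hq) =
    (λ h → q≉0 (zero-product p≉0 (trans (sym (conv-leading d e hp hq))
      (trans (sym (coeff-* p q (d ℕ.+ e))) h)))) ,
    λ k d+e<k → trans (coeff-* p q k) (conv-bounded d e hp hq k d+e<k)

  polynomial-zero-product : ∀ p q → ¬ (p P.≈ P.0#) → p P.* q P.≈ P.0# → q P.≈ P.0#
  polynomial-zero-product p q p≉0 pq≈0 = polynomial-stable q P.0# λ q≉0 →
    degree-exists p p≉0 λ (d , hp) → degree-exists q q≉0 λ (e , hq) →
    proj₁ (degree-* p q d e hp hq) (pq≈0 (d ℕ.+ e))

  -- If p and q have degrees d and e, the coefficient of p q at d + e is nonzero, whereas that of D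
  -- p is a multiple of the coefficient of p at d + e + 1, which is zero.
  D-multiple : ∀ p q → D p P.≈ p P.* q → D p P.≈ P.0#
  D-multiple p q Dp≈pq = polynomial-stable (D p) P.0# λ Dp≉0 →
    degree-exists p (λ p≈0 → Dp≉0 (D-cong p P.0# p≈0)) λ (d , hp) →
    degree-exists q (λ q≈0 → Dp≉0 λ k → trans (Dp≈pq k) (trans
      (CommutativeRing.*-comm polynomialRing p q k) (trans (coeff-* q p k)
      (conv-zeroˡ (coeff p) q≈0 k)))) λ (e , hq) →
    proj₁ (degree-* p q d e hp hq) (trans (sym (Dp≈pq (d ℕ.+ e)))
      (trans (coeff-D p (d ℕ.+ e))
        (·-0 (suc (d ℕ.+ e)) (proj₂ hp (suc (d ℕ.+ e)) (s≤s (ℕ.m≤m+n d e))))))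

  degree0-unit : ∀ p → P.HasDegree p 0 → ¬ ¬ ∃ λ q → p P.* q P.≈ P.1#
  degree0-unit p (p≉0 , hp) ¬goal = inverse p≉0 λ (w , pw≈1) →
    ¬goal (w ∷ [] , λ where
      zero    → trans (coeff-* p (w ∷ []) 0) pw≈1
      (suc k) → trans (coeff-* p (w ∷ []) (suc k))
        (conv-bounded 0 0 hp (λ { (suc i) _ → refl }) (suc k) (s≤s z≤n)))

  monomial : ℕ → Carrier → Poly
  monomial zero    a = a ∷ []
  monomial (suc d) a = 0# ∷ monomial d a

  coeff-monomial : ∀ d a → coeff (monomial d a) d ≈ a
  coeff-monomial zero    a = refl
  coeff-monomial (suc d) a = coeff-monomial d a

  monomial-bounded : ∀ d a → P.DegreeAtMost (monomial d a) d
  monomial-bounded zero    a (suc k) _         = refl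
  monomial-bounded (suc d) a (suc k) (s≤s d<k) = monomial-bounded d a k d<k

  open Gcd polynomialRing

  -- One step of long division: the multiplier is the quotient of the leading coefficients times x
  -- to the power j - i.
  cancel-leading : ∀ p q i j → i ℕ.≤ j → Bounded p (suc i) → Bounded q (suc j) →
    ¬ (coeff p i ≈ 0#) → ¬ ¬ ∃ λ m → Bounded (q P.+ P.neg (m P.* p)) j
  cancel-leading p q i j i≤j hp hq p≉0 ¬goal = inverse p≉0 λ (w , pw≈1) →
    let
      a = w * coeff q j
      m = monomial (j ℕ.∸ i) a
      e+i≡j = ℕ.m∸n+n≡m i≤j
      coeff-q-mp : ∀ k → coeff (q P.+ P.neg (m P.* p)) k ≈ coeff q k - conv (coeff m) (coeff p) k
      coeff-q-mp k = trans (coeff-+ q (P.neg (m P.* p)) k)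
        (+-congˡ (trans (coeff-neg (m P.* p) k) (-‿cong (coeff-* m p k))))
      bounded : Bounded (q P.+ P.neg (m P.* p)) (suc j)
      bounded k j<k = trans (coeff-q-mp k) (0+0 (hq k j<k) (neg0
        (conv-bounded (j ℕ.∸ i) i (monomial-bounded (j ℕ.∸ i) a) hp k
          (≡.subst (ℕ._< k) (≡.sym e+i≡j) j<k))))
      leading : conv (coeff m) (coeff p) j ≈ coeff q j
      leading = begin
        conv (coeff m) (coeff p) j
          ≡⟨ ≡.cong (conv (coeff m) (coeff p)) e+i≡j ⟨
        conv (coeff m) (coeff p) (j ℕ.∸ i ℕ.+ i)
          ≈⟨ conv-leading (j ℕ.∸ i) i (monomial-bounded (j ℕ.∸ i) a) hp ⟩
        coeff m (j ℕ.∸ i) * coeff p i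
          ≈⟨ *-congʳ (coeff-monomial (j ℕ.∸ i) a) ⟩
        w * coeff q j * coeff p i
          ≈⟨ solve 3 (λ w q p → w :* q :* p := p :* w :* q) refl w _ _ ⟩
        coeff p i * w * coeff q j
          ≈⟨ *-congʳ pw≈1 ⟩
        1# * coeff q j
          ≈⟨ *-identityˡ _ ⟩
        coeff q j ∎
    in ¬goal (m , bounded-pred (q P.+ P.neg (m P.* p)) j bounded
      (trans (coeff-q-mp j) (trans (+-congˡ (-‿cong leading)) (-‿inverseʳ _))))

  -- Euclid's algorithm with n as fuel. As the bounds need not be sharp, a vanishing top coefficient
  -- merely lowers its bound; otherwise the polynomial with the larger bound is reduced by the
  -- other. Either way i + j drops by one.
  gcd-bounded : ∀ n i j p q → i ℕ.+ j ℕ.≤ n → Bounded p i → Bounded q j → ¬ ¬ GcdOf p q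
  gcd-bounded n zero j p q _ hp hq ¬goal = ¬goal (gcd-0ˡ p q (λ k → hp k z≤n))
  gcd-bounded n (suc i) zero p q _ hp hq ¬goal =
    ¬goal (gcd-swap q p (gcd-0ˡ q p (λ k → hq k z≤n)))
  gcd-bounded (suc n) (suc i) (suc j) p q (s≤s i+j<n) hp hq ¬goal =
    ¬¬-excluded-middle {A = coeff p i ≈ 0#} λ where
      (yes h) → gcd-bounded n i (suc j) p q i+j<n (bounded-pred p i hp h) hq ¬goal
      (no p≉0) → ¬¬-excluded-middle {A = coeff q j ≈ 0#} λ where
        (yes h) → gcd-bounded n (suc i) j p q i+j≤n hp (bounded-pred q j hq h) ¬goal
        (no q≉0) → reduce p≉0 q≉0
    where
    i+j≤n : suc i ℕ.+ j ℕ.≤ n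
    i+j≤n = ≡.subst (ℕ._≤ n) (ℕ.+-suc i j) i+j<n
    reduce : ¬ (coeff p i ≈ 0#) → ¬ (coeff q j ≈ 0#) → ⊥
    reduce p≉0 q≉0 with ℕ.≤-total i j
    ... | inj₁ i≤j = cancel-leading p q i j i≤j hp hq p≉0 λ (m , h) →
      gcd-bounded n (suc i) j p (q P.+ P.neg (m P.* p)) i+j≤n hp h
        λ g → ¬goal (gcd-subtract p q m g)
    ... | inj₂ j≤i = cancel-leading q p j i j≤i hq hp q≉0 λ (m , h) →
      gcd-bounded n i (suc j) (p P.+ P.neg (m P.* q)) q i+j<n h hq
        λ g → ¬goal (gcd-swap q p (gcd-subtract q p m (gcd-swap (p P.+ P.neg (m P.* q)) q g)))

  polynomialDomain : DifferentialDomain c ℓ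
  polynomialDomain = record
    { commutativeRing = polynomialRing
    ; stable = λ {p} {q} → polynomial-stable p q
    ; 1≉0 = λ h → 1≉0 (h 0)
    ; zero-product = λ {p} {q} → polynomial-zero-product p q
    ; D = D
    ; D-cong = λ {p} {q} → D-cong p q
    ; D-+ = D-+
    ; D-* = D-*
    ; Deg = P.HasDegree
    ; Deg≤ = P.DegreeAtMost
    ; Deg≤-cong = λ h hp k d<k → trans (sym (h k)) (hp k d<k)
    ; Deg≤-+ = λ {p} {q} hp hq k d<k → trans (coeff-+ p q k) (0+0 (hp k d<k) (hq k d<k))
    ; Deg≤-neg = λ {p} hp k d<k → trans (coeff-neg p k) (neg0 (hp k d<k))
    ; Deg≤-* = λ {p} {q} {d} {e} hp hq k d+e<k →
        trans (coeff-* p q k) (conv-bounded d e hp hq k d+e<k)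
    ; Deg≤-D = λ {p} hp k d<k →
        trans (coeff-D p k) (·-0 (suc k) (hp (suc k) (ℕ.m<n⇒m<1+n d<k)))
    ; Deg⇒Deg≤ = proj₂
    ; Deg-least = λ {p} {d} {e} (p≉0 , _) hp → ℕ.≮⇒≥ λ e<d → p≉0 (hp d e<d)
    ; Deg-1 = 1≉0 , λ { (suc k) _ → refl }
    ; Deg-* = λ {p} {q} {d} {e} → degree-* p q d e
    ; Deg-exists = λ {p} → degree-exists p
    ; Deg≤0⇒D≈0 = λ {p} hp k → trans (coeff-D p k) (·-0 (suc k) (hp (suc k) (s≤s z≤n)))
    -- Characteristic zero enters here: the coefficient of `D p` at k is k + 1 times that of p at k
    -- + 1.
    ; D≈0⇒Deg≤0 = λ { {p} h (suc k) _ → ·-zero-product k (trans (sym (coeff-D p k)) (h k)) }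
    ; Deg0-unit = λ {p} → degree0-unit p
    ; D-multiple = λ {p} {q} → D-multiple p q
    ; gcd = λ p q → gcd-bounded _ (length p) (length q) p q ℕ.≤-refl
        (bounded-length p) (bounded-length q)
    }

-- The field of complex numbers

∣p∣*∣p∣≡p*p : ∀ p → ∣ p ∣ ℚ.* ∣ p ∣ ≡ p ℚ.* p
∣p∣*∣p∣≡p*p p with ℚ.∣p∣≡p∨∣p∣≡-p p
... | inj₁ eq = ≡.cong₂ ℚ._*_ eq eq
... | inj₂ eq = ≡.trans (≡.cong₂ ℚ._*_ eq eq)
  (solve 1 (λ p → (:- p) :* (:- p) := p :* p) ≡.refl p)
  where open ℚ-Solver

0≤p*p : ∀ p → 0ℚ ℚ.≤ p ℚ.* p
0≤p*p p = ≡.subst (0ℚ ℚ.≤_) (≡.trans (ℚ.∣p*q∣≡∣p∣*∣q∣ p p) (∣p∣*∣p∣≡p*p p)) (ℚ.0≤∣p∣ (p ℚ.* p))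

∣p∣≤∣q∣+∣q-p∣ : ∀ p q → ∣ p ∣ ℚ.≤ ∣ q ∣ ℚ.+ ∣ q ℚ.- p ∣
∣p∣≤∣q∣+∣q-p∣ p q = ≡.subst (λ x → ∣ x ∣ ℚ.≤ ∣ q ∣ ℚ.+ ∣ q ℚ.- p ∣)
  (solve 2 (λ p q → q :- (q :- p) := p) ≡.refl p q) (ℚ.∣p-q∣≤∣p∣+∣q∣ q (q ℚ.- p))
  where open ℚ-Solver

Null : (ℕ → ℚ) → Set
Null d = ∀ ε → 0ℚ ℚ.< ε → ∃ λ N → ∀ n → N ℕ.≤ n → ∣ d n ∣ ℚ.< ε

null-cong : ∀ d d′ → (∀ n → d n ≡ d′ n) → Null d → Null d′
null-cong d d′ eq h ε 0<ε = let N , k = h ε 0<ε in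
  N , λ n N≤n → ≡.subst (λ x → ∣ x ∣ ℚ.< ε) (eq n) (k n N≤n)

null-zero : ∀ d N → (∀ n → N ℕ.≤ n → d n ≡ 0ℚ) → Null d
null-zero d N eq ε 0<ε = N , λ n N≤n → ≡.subst (λ x → ∣ x ∣ ℚ.< ε) (≡.sym (eq n N≤n)) 0<ε

null-neg : ∀ d → Null d → Null (λ n → ℚ.- d n)
null-neg d h ε 0<ε = let N , k = h ε 0<ε in
  N , λ n N≤n → ≡.subst (ℚ._< ε) (≡.sym (ℚ.∣-p∣≡∣p∣ (d n))) (k n N≤n)

null-+ : ∀ d e → Null d → Null e → Null (λ n → d n ℚ.+ e n)
null-+ d e h k ε 0<ε =
  let M , h′ = h (½ ℚ.* ε) (half-pos ε 0<ε)
      N , k′ = k (½ ℚ.* ε) (half-pos ε 0<ε)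
  in M ℕ.⊔ N , λ n n≥ → begin-strict
    ∣ d n ℚ.+ e n ∣      ≤⟨ ℚ.∣p+q∣≤∣p∣+∣q∣ (d n) (e n) ⟩
    ∣ d n ∣ ℚ.+ ∣ e n ∣  <⟨ ℚ.+-mono-< (h′ n (ℕ.m⊔n≤o⇒m≤o M N n≥)) (k′ n (ℕ.m⊔n≤o⇒n≤o M N n≥)) ⟩
    ½ ℚ.* ε ℚ.+ ½ ℚ.* ε  ≡⟨ half+half ε ⟩
    ε ∎
  where open ℚ.≤-Reasoning

null-* : ∀ a d → IsCauchy a → Null d → Null (λ n → a n ℚ.* d n)
null-* a d ca h ε 0<ε =
  let M , ∣a∣≤B = proj₂ (proj₂ (bounded a ca))
      N , k = h (1/ B ℚ.* ε) (ℚ.positive⁻¹ (1/ B ℚ.* ε) {{ℚ.pos*pos⇒pos (1/ B) ε}})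
  in M ℕ.⊔ N , λ n n≥ → begin-strict
    ∣ a n ℚ.* d n ∣      ≡⟨ ℚ.∣p*q∣≡∣p∣*∣q∣ (a n) (d n) ⟩
    ∣ a n ∣ ℚ.* ∣ d n ∣  ≤⟨ ℚ.*-monoʳ-≤-nonNeg ∣ d n ∣ {{ℚ.∣-∣-nonNeg (d n)}} (∣a∣≤B n (ℕ.m⊔n≤o⇒m≤o M N n≥)) ⟩
    B ℚ.* ∣ d n ∣        <⟨ ℚ.*-monoʳ-<-pos B (k n (ℕ.m⊔n≤o⇒n≤o M N n≥)) ⟩
    B ℚ.* (1/ B ℚ.* ε)   ≡⟨ ℚ.*-assoc B (1/ B) ε ⟨
    B ℚ.* 1/ B ℚ.* ε     ≡⟨ ≡.cong (ℚ._* ε) (ℚ.*-inverseʳ B) ⟩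
    1ℚ ℚ.* ε             ≡⟨ ℚ.*-identityˡ ε ⟩
    ε ∎
  where
  open ℚ.≤-Reasoning
  B = proj₁ (bounded a ca)
  instance
    _ = proj₁ (proj₂ (bounded a ca))
    _ = ℚ.pos⇒nonZero B
    _ = ℚ.1/pos⇒pos B
    _ = positive 0<ε

-- Beyond N the terms differ by less than ε/4, so the decidable comparison of one rational, the
-- absolute value of a N, with ε/2 settles the matter: the later ones stay below 3ε/4 or at least
-- ε/4. The alternatives overlap, which is why the choice can be computed.
null-or-apart : ∀ a → IsCauchy a → ∀ ε → 0ℚ ℚ.< ε →
  ∃ λ N → (∀ n → N ℕ.≤ n → ∣ a n ∣ ℚ.< ε) ⊎ (∀ n → N ℕ.≤ n → ½ ℚ.* (½ ℚ.* ε) ℚ.≤ ∣ a n ∣)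
null-or-apart a ca ε 0<ε with ca δ 0<δ
  where
  δ = ½ ℚ.* (½ ℚ.* ε)
  0<δ = half-pos (½ ℚ.* ε) (half-pos ε 0<ε)
... | N , close with ∣ a N ∣ ℚ.<? ½ ℚ.* ε
... | yes small = N , inj₁ λ n N≤n → begin-strict
    ∣ a n ∣                      ≤⟨ ∣p∣≤∣q∣+∣q-p∣ (a n) (a N) ⟩
    ∣ a N ∣ ℚ.+ ∣ a N ℚ.- a n ∣  <⟨ ℚ.+-mono-< small (close N n ℕ.≤-refl N≤n) ⟩
    ½ ℚ.* ε ℚ.+ δ                ≡⟨ ℚ.+-comm (½ ℚ.* ε) δ ⟩
    δ ℚ.+ ½ ℚ.* ε                ≤⟨ ℚ.+-monoˡ-≤ (½ ℚ.* ε) δ≤ ⟩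
    ½ ℚ.* ε ℚ.+ ½ ℚ.* ε          ≡⟨ half+half ε ⟩
    ε ∎
  where
  open ℚ.≤-Reasoning
  δ = ½ ℚ.* (½ ℚ.* ε)
  δ≤ : δ ℚ.≤ ½ ℚ.* ε
  δ≤ = begin
    δ          ≡⟨ ℚ.+-identityʳ δ ⟨
    δ ℚ.+ 0ℚ   ≤⟨ ℚ.+-monoʳ-≤ δ (ℚ.<⇒≤ (half-pos (½ ℚ.* ε) (half-pos ε 0<ε))) ⟩
    δ ℚ.+ δ    ≡⟨ half+half (½ ℚ.* ε) ⟩
    ½ ℚ.* ε    ∎
... | no large = N , inj₂ λ n N≤n → ℚ.≮⇒≥ λ ∣an∣<δ → large (begin-strict
    ∣ a N ∣                      ≤⟨ ∣p∣≤∣q∣+∣q-p∣ (a N) (a n) ⟩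
    ∣ a n ∣ ℚ.+ ∣ a n ℚ.- a N ∣  <⟨ ℚ.+-mono-< ∣an∣<δ (close n N N≤n ℕ.≤-refl) ⟩
    δ ℚ.+ δ                      ≡⟨ half+half (½ ℚ.* ε) ⟩
    ½ ℚ.* ε ∎)
  where
  open ℚ.≤-Reasoning
  δ = ½ ℚ.* (½ ℚ.* ε)

-- For each ε, the second alternative of `null-or-apart` refutes convergence to 0, so the first one
-- holds and supplies N. Stability of equality in ℝ, and then in ℂ, rests on this.
null-stable : ∀ a → IsCauchy a → ¬ ¬ Null a → Null a
null-stable a ca h ε 0<ε with null-or-apart a ca ε 0<ε
... | N , inj₁ small = N , small
... | N , inj₂ large = ⊥-elim (h λ null →
  let M , k = null (½ ℚ.* (½ ℚ.* ε)) (half-pos (½ ℚ.* ε) (half-pos ε 0<ε)) in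
  ℚ.<-irrefl ≡.refl
    (ℚ.<-≤-trans (k (M ℕ.⊔ N) (ℕ.m≤m⊔n M N)) (large (M ℕ.⊔ N) (ℕ.m≤n⊔m M N))))

Apart : (ℕ → ℚ) → Set
Apart a = ∃ λ δ → 0ℚ ℚ.< δ × ∃ λ N → ∀ n → N ℕ.≤ n → δ ℚ.≤ ∣ a n ∣

¬null⇒apart : ∀ a → IsCauchy a → ¬ Null a → ¬ ¬ Apart a
¬null⇒apart a ca ¬null ¬apart = ¬null λ ε 0<ε → case ε 0<ε (null-or-apart a ca ε 0<ε)
  where
  case : ∀ ε → 0ℚ ℚ.< ε → _ → ∃ λ N → ∀ n → N ℕ.≤ n → ∣ a n ∣ ℚ.< ε
  case ε 0<ε (N , inj₁ small) = N , small
  case ε 0<ε (N , inj₂ large) =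
    ⊥-elim (¬apart (½ ℚ.* (½ ℚ.* ε) , half-pos (½ ℚ.* ε) (half-pos ε 0<ε) , N , large))

-- Reciprocals of Cauchy sequences

recip : ℚ → ℚ
recip p with p ℚ.≟ 0ℚ
-- A default value: a sequence that is eventually bounded away from 0 meets it only at finitely many
-- indices.
... | yes _  = 0ℚ
... | no p≢0 = (1/ p) {{≢-nonZero p≢0}}

*-recip : ∀ p → p ≢ 0ℚ → p ℚ.* recip p ≡ 1ℚ
*-recip p p≢0 with p ℚ.≟ 0ℚ
... | yes p≡0 = ⊥-elim (p≢0 p≡0)
... | no p≢0′ = ℚ.*-inverseʳ p {{≢-nonZero p≢0′}}

module _ {δ : ℚ} (0<δ : 0ℚ ℚ.< δ) where
  private
    instance
      _ = positive 0<δ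
      _ = ℚ.pos⇒nonZero δ
      _ = ℚ.1/pos⇒pos δ

    δ⁻¹ : ℚ
    δ⁻¹ = 1/ δ

  apart⇒≢0 : ∀ p → δ ℚ.≤ ∣ p ∣ → p ≢ 0ℚ
  apart⇒≢0 p δ≤ p≡0 = ℚ.<-irrefl ≡.refl
    (ℚ.<-≤-trans 0<δ (≡.subst (λ x → δ ℚ.≤ ∣ x ∣) p≡0 δ≤))

  ∣recip∣≤ : ∀ p → δ ℚ.≤ ∣ p ∣ → ∣ recip p ∣ ℚ.≤ δ⁻¹
  ∣recip∣≤ p δ≤ = begin
    ∣ recip p ∣                      ≡⟨ ℚ.*-identityˡ _ ⟨
    1ℚ ℚ.* ∣ recip p ∣               ≡⟨ ≡.cong (ℚ._* ∣ recip p ∣) (ℚ.*-inverseˡ δ) ⟨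
    δ⁻¹ ℚ.* δ ℚ.* ∣ recip p ∣        ≤⟨ ℚ.*-monoʳ-≤-nonNeg ∣ recip p ∣ {{ℚ.∣-∣-nonNeg (recip p)}}
                                          (ℚ.*-monoˡ-≤-nonNeg δ⁻¹ {{ℚ.pos⇒nonNeg δ⁻¹}} δ≤) ⟩
    δ⁻¹ ℚ.* ∣ p ∣ ℚ.* ∣ recip p ∣    ≡⟨ ℚ.*-assoc δ⁻¹ _ _ ⟩
    δ⁻¹ ℚ.* (∣ p ∣ ℚ.* ∣ recip p ∣)  ≡⟨ ≡.cong (δ⁻¹ ℚ.*_) (ℚ.∣p*q∣≡∣p∣*∣q∣ p (recip p)) ⟨
    δ⁻¹ ℚ.* ∣ p ℚ.* recip p ∣        ≡⟨ ≡.cong (λ x → δ⁻¹ ℚ.* ∣ x ∣) (*-recip p (apart⇒≢0 p δ≤)) ⟩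
    δ⁻¹ ℚ.* 1ℚ                       ≡⟨ ℚ.*-identityʳ δ⁻¹ ⟩
    δ⁻¹ ∎
    where open ℚ.≤-Reasoning

  -- This is 1/p - 1/q = (q - p)/(p q), with both denominators at least δ in absolute value.
  ∣recip-recip∣≤ : ∀ p q → δ ℚ.≤ ∣ p ∣ → δ ℚ.≤ ∣ q ∣ →
    ∣ recip p ℚ.- recip q ∣ ℚ.≤ δ⁻¹ ℚ.* δ⁻¹ ℚ.* ∣ p ℚ.- q ∣
  ∣recip-recip∣≤ p q δ≤p δ≤q = begin
    ∣ recip p ℚ.- recip q ∣
      ≡⟨ ≡.cong₂ (λ x y → ∣ x ℚ.- y ∣) (lhs q (recip p) δ≤q) (lhs p (recip q) δ≤p) ⟩
    ∣ recip p ℚ.* (q ℚ.* recip q) ℚ.- recip q ℚ.* (p ℚ.* recip p) ∣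
      ≡⟨ ≡.cong ∣_∣ (solve 4 (λ p q r s →
           r :* (q :* s) :- s :* (p :* r) := :- (r :* s :* (p :- q))) ≡.refl p q (recip p) (recip q)) ⟩
    ∣ ℚ.- (recip p ℚ.* recip q ℚ.* (p ℚ.- q)) ∣
      ≡⟨ ℚ.∣-p∣≡∣p∣ (recip p ℚ.* recip q ℚ.* (p ℚ.- q)) ⟩
    ∣ recip p ℚ.* recip q ℚ.* (p ℚ.- q) ∣
      ≡⟨ ≡.trans (ℚ.∣p*q∣≡∣p∣*∣q∣ (recip p ℚ.* recip q) (p ℚ.- q))
           (≡.cong (ℚ._* ∣ p ℚ.- q ∣) (ℚ.∣p*q∣≡∣p∣*∣q∣ (recip p) (recip q))) ⟩
    ∣ recip p ∣ ℚ.* ∣ recip q ∣ ℚ.* ∣ p ℚ.- q ∣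
      ≤⟨ ℚ.*-monoʳ-≤-nonNeg ∣ p ℚ.- q ∣ {{ℚ.∣-∣-nonNeg (p ℚ.- q)}} (ℚ.≤-trans
           (ℚ.*-monoʳ-≤-nonNeg ∣ recip q ∣ {{ℚ.∣-∣-nonNeg (recip q)}} (∣recip∣≤ p δ≤p))
           (ℚ.*-monoˡ-≤-nonNeg δ⁻¹ {{ℚ.pos⇒nonNeg δ⁻¹}} (∣recip∣≤ q δ≤q))) ⟩
    δ⁻¹ ℚ.* δ⁻¹ ℚ.* ∣ p ℚ.- q ∣ ∎
    where
    open ℚ.≤-Reasoning
    open ℚ-Solver
    lhs : ∀ p x → δ ℚ.≤ ∣ p ∣ → x ≡ x ℚ.* (p ℚ.* recip p)
    lhs p x δ≤ = ≡.trans (≡.sym (ℚ.*-identityʳ x)) (≡.cong (x ℚ.*_) (≡.sym (*-recip p (apart⇒≢0 p δ≤))))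

  recip-cauchy : ∀ a → IsCauchy a → ∀ N → (∀ n → N ℕ.≤ n → δ ℚ.≤ ∣ a n ∣) →
    IsCauchy (λ n → recip (a n))
  recip-cauchy a ca N δ≤ ε 0<ε =
    let M , h = scaled a ca (δ⁻¹ ℚ.* δ⁻¹) (ℚ.pos*pos⇒pos δ⁻¹ δ⁻¹) ε 0<ε in
    M ℕ.⊔ N , λ m n m≥ n≥ → ℚ.≤-<-trans
      (∣recip-recip∣≤ (a m) (a n) (δ≤ m (ℕ.m⊔n≤o⇒n≤o M N m≥)) (δ≤ n (ℕ.m⊔n≤o⇒n≤o M N n≥)))
      (h m n (ℕ.m⊔n≤o⇒m≤o M N m≥) (ℕ.m⊔n≤o⇒m≤o M N n≥))

-- The ring of real numbers

module _ where
  open ℚ-Solver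

  pointwise : ∀ x y → (∀ n → seq x n ≡ seq y n) → x ≈ᴿ y
  pointwise x y eq = null-zero _ 0 λ n _ →
    ≡.trans (≡.cong (ℚ._- seq y n) (eq n)) (ℚ.+-inverseʳ (seq y n))

  ≈ᴿ-sym : ∀ x y → x ≈ᴿ y → y ≈ᴿ x
  ≈ᴿ-sym x y h = null-cong (λ n → ℚ.- (seq x n ℚ.- seq y n)) _
    (λ n → solve 2 (λ x y → :- (x :- y) := y :- x) ≡.refl (seq x n) (seq y n))
    (null-neg (λ n → seq x n ℚ.- seq y n) h)

  ≈ᴿ-trans : ∀ x y z → x ≈ᴿ y → y ≈ᴿ z → x ≈ᴿ z
  ≈ᴿ-trans x y z h k = null-cong (λ n → (seq x n ℚ.- seq y n) ℚ.+ (seq y n ℚ.- seq z n)) _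
    (λ n → solve 3 (λ x y z → (x :- y) :+ (y :- z) := x :- z) ≡.refl (seq x n) (seq y n) (seq z n))
    (null-+ (λ n → seq x n ℚ.- seq y n) (λ n → seq y n ℚ.- seq z n) h k)

  +ᴿ-cong : ∀ x x′ y y′ → x ≈ᴿ x′ → y ≈ᴿ y′ → x +ᴿ y ≈ᴿ x′ +ᴿ y′
  +ᴿ-cong x x′ y y′ h k = null-cong (λ n → (seq x n ℚ.- seq x′ n) ℚ.+ (seq y n ℚ.- seq y′ n)) _
    (λ n → solve 4 (λ x x′ y y′ → (x :- x′) :+ (y :- y′) := (x :+ y) :- (x′ :+ y′)) ≡.refl
      (seq x n) (seq x′ n) (seq y n) (seq y′ n))
    (null-+ (λ n → seq x n ℚ.- seq x′ n) (λ n → seq y n ℚ.- seq y′ n) h k)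

  -ᴿ-cong : ∀ x x′ → x ≈ᴿ x′ → -ᴿ x ≈ᴿ -ᴿ x′
  -ᴿ-cong x x′ h = null-cong (λ n → ℚ.- (seq x n ℚ.- seq x′ n)) _
    (λ n → solve 2 (λ x y → :- (x :- y) := (:- x) :- (:- y)) ≡.refl (seq x n) (seq x′ n))
    (null-neg (λ n → seq x n ℚ.- seq x′ n) h)

  *ᴿ-cong : ∀ x x′ y y′ → x ≈ᴿ x′ → y ≈ᴿ y′ → x *ᴿ y ≈ᴿ x′ *ᴿ y′
  *ᴿ-cong x x′ y y′ h k = null-cong
    (λ n → seq x n ℚ.* (seq y n ℚ.- seq y′ n) ℚ.+ seq y′ n ℚ.* (seq x n ℚ.- seq x′ n)) _
    (λ n → solve 4 (λ x x′ y y′ → x :* (y :- y′) :+ y′ :* (x :- x′) := x :* y :- x′ :* y′) ≡.refl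
      (seq x n) (seq x′ n) (seq y n) (seq y′ n))
    (null-+ (λ n → seq x n ℚ.* (seq y n ℚ.- seq y′ n)) (λ n → seq y′ n ℚ.* (seq x n ℚ.- seq x′ n))
      (null-* (seq x) (λ n → seq y n ℚ.- seq y′ n) (cauchy x) k)
      (null-* (seq y′) (λ n → seq x n ℚ.- seq x′ n) (cauchy y′) h))

ℝ-ring : CommutativeRing 0ℓ 0ℓ
ℝ-ring = record
  { Carrier = ℝ ; _≈_ = _≈ᴿ_ ; _+_ = _+ᴿ_ ; _*_ = _*ᴿ_ ; -_ = -ᴿ_
  ; 0# = fromℚ 0ℚ ; 1# = fromℚ 1ℚ
  ; isCommutativeRing = record
    { isRing = record
      { +-isAbelianGroup = record
        { isGroup = record
          { isMonoid = record
            { isSemigroup = record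
              { isMagma = record
                { isEquivalence = record
                  { refl  = λ {x} → pointwise x x λ _ → ≡.refl
                  ; sym   = λ {x} {y} → ≈ᴿ-sym x y
                  ; trans = λ {x} {y} {z} → ≈ᴿ-trans x y z
                  }
                ; ∙-cong = λ {x} {x′} {y} {y′} → +ᴿ-cong x x′ y y′
                }
              ; assoc = λ x y z → pointwise ((x +ᴿ y) +ᴿ z) (x +ᴿ (y +ᴿ z))
                  λ n → ℚ.+-assoc (seq x n) (seq y n) (seq z n)
              }
            ; identity = (λ x → pointwise (fromℚ 0ℚ +ᴿ x) x λ n → ℚ.+-identityˡ (seq x n))
                , (λ x → pointwise (x +ᴿ fromℚ 0ℚ) x λ n → ℚ.+-identityʳ (seq x n))
            }
          ; inverse = (λ x → pointwise ((-ᴿ x) +ᴿ x) (fromℚ 0ℚ) λ n → ℚ.+-inverseˡ (seq x n))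
              , (λ x → pointwise (x +ᴿ (-ᴿ x)) (fromℚ 0ℚ) λ n → ℚ.+-inverseʳ (seq x n))
          ; ⁻¹-cong = λ {x} {y} → -ᴿ-cong x y
          }
        ; comm = λ x y → pointwise (x +ᴿ y) (y +ᴿ x) λ n → ℚ.+-comm (seq x n) (seq y n)
        }
      ; *-cong = λ {x} {x′} {y} {y′} → *ᴿ-cong x x′ y y′
      ; *-assoc = λ x y z → pointwise ((x *ᴿ y) *ᴿ z) (x *ᴿ (y *ᴿ z))
          λ n → ℚ.*-assoc (seq x n) (seq y n) (seq z n)
      ; *-identity = (λ x → pointwise (fromℚ 1ℚ *ᴿ x) x λ n → ℚ.*-identityˡ (seq x n))
          , (λ x → pointwise (x *ᴿ fromℚ 1ℚ) x λ n → ℚ.*-identityʳ (seq x n))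
      ; distrib = (λ x y z → pointwise (x *ᴿ (y +ᴿ z)) (x *ᴿ y +ᴿ x *ᴿ z)
            λ n → ℚ.*-distribˡ-+ (seq x n) (seq y n) (seq z n))
          , (λ x y z → pointwise ((y +ᴿ z) *ᴿ x) (y *ᴿ x +ᴿ z *ᴿ x)
            λ n → ℚ.*-distribʳ-+ (seq x n) (seq y n) (seq z n))
      }
    ; *-comm = λ x y → pointwise (x *ᴿ y) (y *ᴿ x) λ n → ℚ.*-comm (seq x n) (seq y n)
    }
  }

≈ᴿ-stable : ∀ x y → ¬ ¬ (x ≈ᴿ y) → x ≈ᴿ y
≈ᴿ-stable x y = null-stable (seq (x -ᴿ y)) (cauchy (x -ᴿ y))

≈ᴿ0⇒null : ∀ x → x ≈ᴿ fromℚ 0ℚ → Null (seq x)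
≈ᴿ0⇒null x = null-cong (λ n → seq x n ℚ.- 0ℚ) (seq x) λ n → ℚ.+-identityʳ (seq x n)

null⇒≈ᴿ0 : ∀ x → Null (seq x) → x ≈ᴿ fromℚ 0ℚ
null⇒≈ᴿ0 x = null-cong (seq x) (λ n → seq x n ℚ.- 0ℚ) λ n → ≡.sym (ℚ.+-identityʳ (seq x n))

ℝ-inverse : ∀ x → ¬ (x ≈ᴿ fromℚ 0ℚ) → ¬ ¬ ∃ λ y → x *ᴿ y ≈ᴿ fromℚ 1ℚ
ℝ-inverse x x≉0 ¬goal = ¬null⇒apart (seq x) (cauchy x) (λ h → x≉0 (null⇒≈ᴿ0 x h))
  λ (δ , 0<δ , N , δ≤) → ¬goal
    ( mkℝ (λ n → recip (seq x n)) (recip-cauchy 0<δ (seq x) (cauchy x) N δ≤)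
    , null-zero _ N λ n N≤n →
        ≡.cong (ℚ._- 1ℚ) (*-recip (seq x n) (apart⇒≢0 0<δ (seq x n) (δ≤ n N≤n))))

squares≈0⇒≈0 : ∀ x y → x *ᴿ x +ᴿ y *ᴿ y ≈ᴿ fromℚ 0ℚ → x ≈ᴿ fromℚ 0ℚ
squares≈0⇒≈0 x y h = null⇒≈ᴿ0 x λ ε 0<ε →
  let
    instance _ = positive 0<ε
    instance _ = ℚ.pos⇒nonNeg ε
    -- The tolerance is ε² because a term of x with absolute value at least ε makes the sum of
    -- squares at least ε².
    N , k = ≈ᴿ0⇒null (x *ᴿ x +ᴿ y *ᴿ y) h (ε ℚ.* ε) (ℚ.positive⁻¹ (ε ℚ.* ε) {{ℚ.pos*pos⇒pos ε ε}})
  in N , λ n N≤n → ℚ.≰⇒> λ ε≤ → let a = seq x n ; b = seq y n in ℚ.<-irrefl ≡.refl (begin-strict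
    ε ℚ.* ε          ≤⟨ ℚ.*-monoˡ-≤-nonNeg ε ε≤ ⟩
    ε ℚ.* ∣ a ∣      ≤⟨ ℚ.*-monoʳ-≤-nonNeg ∣ a ∣ {{ℚ.∣-∣-nonNeg a}} ε≤ ⟩
    ∣ a ∣ ℚ.* ∣ a ∣  ≡⟨ ∣p∣*∣p∣≡p*p a ⟩
    a ℚ.* a          ≡⟨ ℚ.+-identityʳ _ ⟨
    a ℚ.* a ℚ.+ 0ℚ   ≤⟨ ℚ.+-monoʳ-≤ (a ℚ.* a) (0≤p*p b) ⟩
    a ℚ.* a ℚ.+ b ℚ.* b
      ≡⟨ ℚ.0≤p⇒∣p∣≡p (ℚ.+-mono-≤ (0≤p*p a) (0≤p*p b)) ⟨
    ∣ a ℚ.* a ℚ.+ b ℚ.* b ∣  <⟨ k n N≤n ⟩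
    ε ℚ.* ε ∎)
  where open ℚ.≤-Reasoning

-- The laws of ℂ split into identities of commutative rings for the real and imaginary parts; (a,
-- b), (c, d), (e, f) are the parts of three complex numbers.
module Complexification {c ℓ} (R : CommutativeRing c ℓ) where
  open CommutativeRing R
  open IntegerCoefficientSolver R

  re-assoc : ∀ a b c d e f →
    (a * c - b * d) * e - (a * d + b * c) * f ≈ a * (c * e - d * f) - b * (c * f + d * e)
  re-assoc = solve 6 (λ a b c d e f →
    (a :* c :- b :* d) :* e :- (a :* d :+ b :* c) :* f
    := a :* (c :* e :- d :* f) :- b :* (c :* f :+ d :* e)) refl

  im-assoc : ∀ a b c d e f →
    (a * c - b * d) * f + (a * d + b * c) * e ≈ a * (c * f + d * e) + b * (c * e - d * f)
  im-assoc = solve 6 (λ a b c d e f →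
    (a :* c :- b :* d) :* f :+ (a :* d :+ b :* c) :* e
    := a :* (c :* f :+ d :* e) :+ b :* (c :* e :- d :* f)) refl

  re-distribʳ : ∀ a b c d e f → (c + e) * a - (d + f) * b ≈ (c * a - d * b) + (e * a - f * b)
  re-distribʳ = solve 6 (λ a b c d e f → (c :+ e) :* a :- (d :+ f) :* b
    := (c :* a :- d :* b) :+ (e :* a :- f :* b)) refl

  im-distribʳ : ∀ a b c d e f → (c + e) * b + (d + f) * a ≈ (c * b + d * a) + (e * b + f * a)
  im-distribʳ = solve 6 (λ a b c d e f → (c :+ e) :* b :+ (d :+ f) :* a
    := (c :* b :+ d :* a) :+ (e :* b :+ f :* a)) refl

  re-distribˡ : ∀ a b c d e f → a * (c + e) - b * (d + f) ≈ (a * c - b * d) + (a * e - b * f)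
  re-distribˡ = solve 6 (λ a b c d e f → a :* (c :+ e) :- b :* (d :+ f)
    := (a :* c :- b :* d) :+ (a :* e :- b :* f)) refl

  im-distribˡ : ∀ a b c d e f → a * (d + f) + b * (c + e) ≈ (a * d + b * c) + (a * f + b * e)
  im-distribˡ = solve 6 (λ a b c d e f → a :* (d :+ f) :+ b :* (c :+ e)
    := (a :* d :+ b :* c) :+ (a :* f :+ b :* e)) refl

  re-identityˡ : ∀ a b → 1# * a - 0# * b ≈ a
  re-identityˡ = solve 2 (λ a b → con (+ 1) :* a :- con (+ 0) :* b := a) refl

  im-identityˡ : ∀ a b → 1# * b + 0# * a ≈ b
  im-identityˡ = solve 2 (λ a b → con (+ 1) :* b :+ con (+ 0) :* a := b) refl

  re-identityʳ : ∀ a b → a * 1# - b * 0# ≈ a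
  re-identityʳ = solve 2 (λ a b → a :* con (+ 1) :- b :* con (+ 0) := a) refl

  im-identityʳ : ∀ a b → a * 0# + b * 1# ≈ b
  im-identityʳ = solve 2 (λ a b → a :* con (+ 0) :+ b :* con (+ 1) := b) refl

  re-comm : ∀ a b c d → a * c - b * d ≈ c * a - d * b
  re-comm = solve 4 (λ a b c d → a :* c :- b :* d := c :* a :- d :* b) refl

  im-comm : ∀ a b c d → a * d + b * c ≈ c * b + d * a
  im-comm = solve 4 (λ a b c d → a :* d :+ b :* c := c :* b :+ d :* a) refl

  -- With m the inverse of the norm, the inverse of a + i b is its conjugate times m.
  re-inverse : ∀ a b m → (a * a + b * b) * m ≈ 1# → a * (a * m) - b * - (b * m) ≈ 1#
  re-inverse a b m h = trans (solve 3 (λ a b m →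
    a :* (a :* m) :- b :* :- (b :* m) := (a :* a :+ b :* b) :* m) refl a b m) h

  im-inverse : ∀ a b m → a * - (b * m) + b * (a * m) ≈ 0#
  im-inverse = solve 3 (λ a b m → a :* :- (b :* m) :+ b :* (a :* m) := con (+ 0)) refl

ℂ-ring : CommutativeRing 0ℓ 0ℓ
ℂ-ring = record
  { Carrier = ℂ ; _≈_ = C._≈_ ; _+_ = C._+_ ; _*_ = C._*_ ; -_ = C.-_ ; 0# = C.0# ; 1# = C.1#
  ; isCommutativeRing = record
    { isRing = record
      { +-isAbelianGroup = record
        { isGroup = record
          { isMonoid = record
            { isSemigroup = record
              { isMagma = record
                { isEquivalence = record
                  { refl  = λ {z} → R.refl {re z} , R.refl {im z}
                  ; sym   = λ {z} {w} (h , k) → R.sym {re z} {re w} h , R.sym {im z} {im w} k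
                  ; trans = λ {z} {w} {v} (h , k) (h′ , k′) →
                      R.trans {re z} {re w} {re v} h h′ , R.trans {im z} {im w} {im v} k k′
                  }
                ; ∙-cong = λ {z} {z′} {w} {w′} (h , k) (h′ , k′) →
                    R.+-cong {re z} {re z′} {re w} {re w′} h h′ ,
                    R.+-cong {im z} {im z′} {im w} {im w′} k k′
                }
              ; assoc = λ z w v → R.+-assoc (re z) (re w) (re v) , R.+-assoc (im z) (im w) (im v)
              }
            ; identity = (λ z → R.+-identityˡ (re z) , R.+-identityˡ (im z))
                , (λ z → R.+-identityʳ (re z) , R.+-identityʳ (im z))
            }
          ; inverse = (λ z → R.-‿inverseˡ (re z) , R.-‿inverseˡ (im z))
              , (λ z → R.-‿inverseʳ (re z) , R.-‿inverseʳ (im z))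
          ; ⁻¹-cong = λ {z} {w} (h , k) →
              R.-‿cong {re z} {re w} h , R.-‿cong {im z} {im w} k
          }
        ; comm = λ z w → R.+-comm (re z) (re w) , R.+-comm (im z) (im w)
        }
      ; *-cong = λ {z} {z′} {w} {w′} (h , k) (h′ , k′) →
          +ᴿ-cong (re z *ᴿ re w) (re z′ *ᴿ re w′) (-ᴿ (im z *ᴿ im w)) (-ᴿ (im z′ *ᴿ im w′))
            (*ᴿ-cong (re z) (re z′) (re w) (re w′) h h′)
            (-ᴿ-cong (im z *ᴿ im w) (im z′ *ᴿ im w′) (*ᴿ-cong (im z) (im z′) (im w) (im w′) k k′)) ,
          +ᴿ-cong (re z *ᴿ im w) (re z′ *ᴿ im w′) (im z *ᴿ re w) (im z′ *ᴿ re w′)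
            (*ᴿ-cong (re z) (re z′) (im w) (im w′) h k′)
            (*ᴿ-cong (im z) (im z′) (re w) (re w′) k h′)
      ; *-assoc = λ z w v →
          re-assoc (re z) (im z) (re w) (im w) (re v) (im v) ,
          im-assoc (re z) (im z) (re w) (im w) (re v) (im v)
      ; *-identity = (λ z → re-identityˡ (re z) (im z) , im-identityˡ (re z) (im z))
          , (λ z → re-identityʳ (re z) (im z) , im-identityʳ (re z) (im z))
      ; distrib = (λ z w v →
            re-distribˡ (re z) (im z) (re w) (im w) (re v) (im v) ,
            im-distribˡ (re z) (im z) (re w) (im w) (re v) (im v))
          , (λ z w v →
            re-distribʳ (re z) (im z) (re w) (im w) (re v) (im v) ,
            im-distribʳ (re z) (im z) (re w) (im w) (re v) (im v))
      }
    ; *-comm = λ z w →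
        re-comm (re z) (im z) (re w) (im w) , im-comm (re z) (im z) (re w) (im w)
    }
  }
  where
  module C = RawRing ℂ-rawRing
  module R = CommutativeRing ℝ-ring
  open Complexification ℝ-ring

module _ where
  open CommutativeRing ℂ-ring
  open MonoidMult +-monoid using () renaming (_×_ to _·_)
  private module R = CommutativeRing ℝ-ring
  open Complexification ℝ-ring

  ℂ-stable : ∀ z w → ¬ ¬ (z ≈ w) → z ≈ w
  ℂ-stable z w h =
    ≈ᴿ-stable (re z) (re w) (λ ¬eq → h λ (eq , _) → ¬eq eq) ,
    ≈ᴿ-stable (im z) (im w) (λ ¬eq → h λ (_ , eq) → ¬eq eq)

  ℂ-inverse : ∀ z → ¬ (z ≈ 0#) → ¬ ¬ ∃ λ w → z * w ≈ 1#
  ℂ-inverse z@(x +i y) z≉0 ¬goal = ℝ-inverse (x *ᴿ x +ᴿ y *ᴿ y)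
    (λ N≈0 → z≉0 (squares≈0⇒≈0 x y N≈0 ,
      squares≈0⇒≈0 y x (R.trans {y *ᴿ y +ᴿ x *ᴿ x} {x *ᴿ x +ᴿ y *ᴿ y} {fromℚ 0ℚ}
        (R.+-comm (y *ᴿ y) (x *ᴿ x)) N≈0)))
    λ (m , Nm≈1) → ¬goal ((x *ᴿ m) +i (-ᴿ (y *ᴿ m)) , re-inverse x y m Nm≈1 , im-inverse x y m)

  0≤n·1 : ∀ n k → 0ℚ ℚ.≤ seq (re (n · 1#)) k
  0≤n·1 zero    k = ℚ.≤-refl
  0≤n·1 (suc n) k = ℚ.+-mono-≤ {0ℚ} {1ℚ} (ℚ.<⇒≤ (ℚ.positive⁻¹ 1ℚ)) (0≤n·1 n k)

  -- Every term of the rational sequence for the real part is at least 1, so the sequence cannot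
  -- tend to 0.
  ℂ-characteristic : ∀ n → ¬ (suc n · 1# ≈ 0#)
  ℂ-characteristic n (h , _) =
    let N , k = ≈ᴿ0⇒null (re (suc n · 1#)) h 1ℚ (ℚ.positive⁻¹ 1ℚ)
        a = seq (re (n · 1#)) N
    in ℚ.<-irrefl ≡.refl (begin-strict
      1ℚ              ≡⟨ ℚ.+-identityʳ 1ℚ ⟨
      1ℚ ℚ.+ 0ℚ       ≤⟨ ℚ.+-monoʳ-≤ 1ℚ (0≤n·1 n N) ⟩
      1ℚ ℚ.+ a        ≡⟨ ℚ.0≤p⇒∣p∣≡p (0≤n·1 (suc n) N) ⟨
      ∣ 1ℚ ℚ.+ a ∣    <⟨ k N ℕ.≤-refl ⟩
      1ℚ ∎)
    where open ℚ.≤-Reasoning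

ℂ-field : ClassicalField 0ℓ 0ℓ
ℂ-field = record
  { commutativeRing = ℂ-ring
  ; stable          = λ {z} {w} → ℂ-stable z w
  ; inverse         = λ {z} → ℂ-inverse z
  ; characteristic  = ℂ-characteristic
  }

open ℂ[x]

-- Equal sums of powers in ℂ[x]

-- Names the existential as a family in n, so that n can be traded for the form 16 + j by
-- substitution.
Counterexample : ℕ → Set
Counterexample n = Σ[ p ∈ ℂ[x] ] Σ[ q ∈ ℂ[x] ] Σ[ r ∈ ℂ[x] ] Σ[ s ∈ ℂ[x] ]
  ( (p ^ n + q ^ n ≈ r ^ n + s ^ n × ¬ (p ^ n + q ^ n ≈ 0#))
  × ¬ (⟅ p ^ n , q ^ n ⟆ ≐ ⟅ r ^ n , s ^ n ⟆)
  × (∃ λ d → MaxDegree (p ∷ q ∷ r ∷ s ∷ []) d × 1 ≤ d)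
  × GcdIsOne (p ∷ q ∷ r ∷ s ∷ []) )

module ℂ[x]-ring = CommutativeRing (PolynomialRing.polynomialRing ℂ-field)
module ℂ[x]-domain = DifferentialDomain (PolynomialRing.polynomialDomain ℂ-field)
open EqualPowerSums (PolynomialRing.polynomialDomain ℂ-field) using (equal-sums⇒const)

⟅⟆-cong : ∀ {f g h k} → f ≈ h → g ≈ k → ⟅ f , g ⟆ ≐ ⟅ h , k ⟆
⟅⟆-cong {f} {g} {h} {k} f≈h g≈k =
  (λ { {t} (inj₁ t≈f) → inj₁ (ℂ[x]-ring.trans {t} {f} {h} t≈f f≈h)
     ; {t} (inj₂ t≈g) → inj₂ (ℂ[x]-ring.trans {t} {g} {k} t≈g g≈k) }) ,
  (λ { {t} (inj₁ t≈h) → inj₁ (ℂ[x]-ring.trans {t} {h} {f} t≈h (ℂ[x]-ring.sym {f} {h} f≈h))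
     ; {t} (inj₂ t≈k) → inj₂ (ℂ[x]-ring.trans {t} {k} {g} t≈k (ℂ[x]-ring.sym {g} {k} g≈k)) })

⟅⟆-cong-swap : ∀ {f g h k} → f ≈ k → g ≈ h → ⟅ f , g ⟆ ≐ ⟅ h , k ⟆
⟅⟆-cong-swap {f} {g} {h} {k} f≈k g≈h =
  (λ { {t} (inj₁ t≈f) → inj₂ (ℂ[x]-ring.trans {t} {f} {k} t≈f f≈k)
     ; {t} (inj₂ t≈g) → inj₁ (ℂ[x]-ring.trans {t} {g} {h} t≈g g≈h) }) ,
  (λ { {t} (inj₁ t≈h) → inj₂ (ℂ[x]-ring.trans {t} {h} {g} t≈h (ℂ[x]-ring.sym {g} {h} g≈h))
     ; {t} (inj₂ t≈k) → inj₁ (ℂ[x]-ring.trans {t} {k} {f} t≈k (ℂ[x]-ring.sym {f} {k} f≈k)) })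

factor⇒∣ : ∀ {p t a} → p ≈ t * a → t ∣ p
factor⇒∣ {p} {t} {a} p≈ta = a RawMagmaDefinitions.,
  ℂ[x]-ring.trans {a * t} {t * a} {p} (ℂ[x]-ring.*-comm a t) (ℂ[x]-ring.sym {p} {t * a} p≈ta)

-- Passes from degrees to derivatives: a common divisor with nonzero derivative would have positive
-- degree, contradicting coprimality.
common-divisor⇒const : ∀ {p q r s} → GcdIsOne (p ∷ q ∷ r ∷ s ∷ []) →
  ∀ t a b c d → p ≈ t * a → q ≈ t * b → r ≈ t * c → s ≈ t * d → ℂ[x]-domain.D t ≈ 0#
common-divisor⇒const {p} {q} {r} {s} coprime t a b c d p≈ q≈ r≈ s≈ =
  ℂ[x]-domain.stable {ℂ[x]-domain.D t} {0#} λ Dt≉0 →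
  ℂ[x]-domain.Deg-exists {t} (λ t≈0 → Dt≉0 (ℂ[x]-domain.D-cong {t} {0#} t≈0)) λ where
    (zero  , ht) → Dt≉0 (ℂ[x]-domain.Deg≤0⇒D≈0 {t} (proj₂ ht))
    (suc e , ht) → coprime (t , (suc e , ht , s≤s z≤n) ,
      factor⇒∣ {p} {t} {a} p≈ ∷ factor⇒∣ {q} {t} {b} q≈ ∷
      factor⇒∣ {r} {t} {c} r≈ ∷ factor⇒∣ {s} {t} {d} s≈ ∷ [])

const⇒degree≯0 : ∀ p {d} → ℂ[x]-domain.D p ≈ 0# → HasDegree p d → ¬ (1 ≤ d)
const⇒degree≯0 p Dp≈0 (p≉0 , _) 1≤d = p≉0 (ℂ[x]-domain.D≈0⇒Deg≤0 {p} Dp≈0 _ 1≤d)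

no-counterexample : ∀ j → ¬ Counterexample (16 ℕ.+ j)
no-counterexample j
  (p , q , r , s , (equation , sum≉0) , sets≢ , (d , (degrees , _) , 1≤d) , coprime) =
  contradiction degrees
  where
  n = 16 ℕ.+ j
  constants = equal-sums⇒const j {p} {q} {r} {s} equation sum≉0
    (λ (p≈r , q≈s) → sets≢ (⟅⟆-cong {p ^ n} {q ^ n} {r ^ n} {s ^ n} p≈r q≈s))
    (λ (p≈s , q≈r) → sets≢ (⟅⟆-cong-swap {p ^ n} {q ^ n} {r ^ n} {s ^ n} p≈s q≈r))
    (common-divisor⇒const {p} {q} {r} {s} coprime)
  contradiction : ¬ Any (λ p → HasDegree p d) (p ∷ q ∷ r ∷ s ∷ [])
  contradiction (here h) = const⇒degree≯0 p (proj₁ constants) h 1≤d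
  contradiction (there (here h)) = const⇒degree≯0 q (proj₁ (proj₂ constants)) h 1≤d
  contradiction (there (there (here h))) =
    const⇒degree≯0 r (proj₁ (proj₂ (proj₂ constants))) h 1≤d
  contradiction (there (there (there (here h)))) =
    const⇒degree≯0 s (proj₂ (proj₂ (proj₂ constants))) h 1≤d

theorem2p1 : (n : ℕ) → 16 ≤ n →
    ¬ (Σ[ p ∈ ℂ[x] ] Σ[ q ∈ ℂ[x] ] Σ[ r ∈ ℂ[x] ] Σ[ s ∈ ℂ[x] ]
    ( (p ^ n + q ^ n ≈ r ^ n + s ^ n × ¬ (p ^ n + q ^ n ≈ 0#))
    × ¬ (⟅ p ^ n , q ^ n ⟆ ≐ ⟅ r ^ n , s ^ n ⟆)
    × (∃ λ d → MaxDegree (p ∷ q ∷ r ∷ s ∷ []) d × 1 ≤ d)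
    × GcdIsOne (p ∷ q ∷ r ∷ s ∷ []) ))
theorem2p1 n 16≤n = let j , 16+j≡n = ℕ.m≤n⇒∃[o]m+o≡n 16≤n in
  ≡.subst (λ n → ¬ Counterexample n) 16+j≡n (no-counterexample j)
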